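{- Let $0<q\in\mathbb{Q}$, $\gamma\in\mathbb{N}$, $\delta\in\mathbb{N}\cup\{0\}$ and $N\in\mathbb{N}$. The summation formula $$\sum_{n=0}^{\infty}((\gamma n+\delta)!)^{\gamma n+\delta-1}x^{\gamma n}\left\{\frac{[(\gamma(n+1)+\delta)!]^{\gamma}\,\big((\gamma n+\delta+1)_{\gamma}\big)^{\gamma n+\delta-1}}{q+[(\gamma(n+1)+\delta)!]^{N(\gamma(n+1)+\delta)}}\,x^{\gamma}-\frac{1}{q+((\gamma n+\delta)!)^{N(\gamma n+\delta)}}\right\}=-\frac{(\delta!)^{\delta-1}}{q+(\delta!)^{N\delta}}$$ is valid for all non-zero $x\in\mathbb{R}$ (with the sum taken in $\mathbb{R}$), and for all non-zero $x\in\mathbb{Q}_p$ (with the sum taken in $\mathbb{Q}_p$) for every prime $p$.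
   Context: $\mathbb{N}$ denotes the positive integers. $(\gamma n+\delta+1)_{\gamma}=(\gamma n+\delta+1)(\gamma n+\delta+2)\cdots(\gamma n+\delta+\gamma)$. $\mathbb{Q}_p$ is the field of $p$-adic numbers with its $p$-adic absolute value. -}

module Defs where

open import Data.Empty using (⊥-elim)
open import Data.Integer.Base as ℤ using (ℤ; +_; -[1+_])
import Data.Integer.Divisibility as ℤᵈ
import Data.Integer.Divisibility.Signed as ℤˢ
import Data.Integer.Properties as ℤ
open import Data.Nat.Base as ℕ using (ℕ; zero; suc; _!)
open import Data.Nat.Divisibility as ℕᵈ using (_∣_; _∣?_; divides)
open import Data.Nat.Primality using (Prime; prime⇒nonZero; prime⇒nonTrivial; euclidsLemma)
import Data.Nat.Properties as ℕ
import Data.Nat.Solver as ℕSolver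
open import Data.Product.Base using (Σ; ∃; _×_; _,_)
open import Data.Rational.Base as ℚ using (ℚ; 0ℚ; 1ℚ; ½; ↥_; ↧_; ↧ₙ_)
import Data.Rational.Properties as ℚ
import Data.Rational.Solver as ℚSolver
import Data.Rational.Unnormalised.Base as ℚᵘ
import Data.Rational.Unnormalised.Properties as ℚᵘ
open import Data.Sum.Base using (_⊎_; inj₁; inj₂)
open import Relation.Binary.PropositionalEquality
open import Relation.Nullary using (¬_; yes; no)

-- Only rational-valued ones: this covers the usual one and the p-adic ones.
record AbsoluteValue : Set where
  field
    ∣_∣       : ℚ → ℚ
    0≤∣_∣     : ∀ x → 0ℚ ℚ.≤ ∣ x ∣
    ∣0∣≡0     : ∣ 0ℚ ∣ ≡ 0ℚ
    ∣x∣≡0⇒x≡0 : ∀ x → ∣ x ∣ ≡ 0ℚ → x ≡ 0ℚ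
    ∣x*y∣     : ∀ x y → ∣ x ℚ.* y ∣ ≡ ∣ x ∣ ℚ.* ∣ y ∣
    ∣x+y∣≤    : ∀ x y → ∣ x ℚ.+ y ∣ ℚ.≤ ∣ x ∣ ℚ.+ ∣ y ∣

usual : AbsoluteValue
usual = record
  { ∣_∣       = ℚ.∣_∣
  ; 0≤∣_∣     = ℚ.0≤∣p∣
  ; ∣0∣≡0     = refl
  ; ∣x∣≡0⇒x≡0 = ℚ.∣p∣≡0⇒p≡0
  ; ∣x*y∣     = ℚ.∣p*q∣≡∣p∣*∣q∣
  ; ∣x+y∣≤    = ℚ.∣p+q∣≤∣p∣+∣q∣
  }

private
  frac-≡ : ∀ m n m′ n′ .{{_ : ℕ.NonZero n}} .{{_ : ℕ.NonZero n′}} →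
           m ℕ.* n′ ≡ m′ ℕ.* n → + m ℚ./ n ≡ + m′ ℚ./ n′
  frac-≡ m (suc n) m′ (suc n′) eq = ℚ.fromℚᵘ-cong {ℚᵘ.mkℚᵘ (+ m) n} {ℚᵘ.mkℚᵘ (+ m′) n′} (ℚᵘ.*≡* (begin
    + m ℤ.* + suc n′     ≡⟨ ℤ.pos-* m (suc n′) ⟨
    + (m ℕ.* suc n′)     ≡⟨ cong +_ eq ⟩
    + (m′ ℕ.* suc n)     ≡⟨ ℤ.pos-* m′ (suc n) ⟩
    + m′ ℤ.* + suc n     ∎))
    where open ≡-Reasoning

  frac-* : ∀ m n m′ n′ .{{_ : ℕ.NonZero n}} .{{_ : ℕ.NonZero n′}} →
           .{{_ : ℕ.NonZero (n ℕ.* n′)}} →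
           + (m ℕ.* m′) ℚ./ (n ℕ.* n′) ≡ (+ m ℚ./ n) ℚ.* (+ m′ ℚ./ n′)
  frac-* m (suc n) m′ (suc n′) = ℚ.toℚᵘ-injective (begin
    ℚ.toℚᵘ (+ (m ℕ.* m′) ℚ./ (suc n ℕ.* suc n′))
      ≈⟨ ℚ.toℚᵘ-fromℚᵘ (ℚᵘ.mkℚᵘ (+ (m ℕ.* m′)) (n′ ℕ.+ n ℕ.* suc n′)) ⟩
    ℚᵘ.mkℚᵘ (+ (m ℕ.* m′)) (n′ ℕ.+ n ℕ.* suc n′)
      ≈⟨ ℚᵘ.*≡* (cong (ℤ._* + (suc n ℕ.* suc n′)) (ℤ.pos-* m m′)) ⟩
    ℚᵘ.mkℚᵘ (+ m) n ℚᵘ.* ℚᵘ.mkℚᵘ (+ m′) n′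
      ≈⟨ ℚᵘ.*-cong (ℚ.toℚᵘ-fromℚᵘ (ℚᵘ.mkℚᵘ (+ m) n)) (ℚ.toℚᵘ-fromℚᵘ (ℚᵘ.mkℚᵘ (+ m′) n′)) ⟨
    ℚ.toℚᵘ (+ m ℚ./ suc n) ℚᵘ.* ℚ.toℚᵘ (+ m′ ℚ./ suc n′)
      ≈⟨ ℚ.toℚᵘ-homo-* (+ m ℚ./ suc n) (+ m′ ℚ./ suc n′) ⟨
    ℚ.toℚᵘ ((+ m ℚ./ suc n) ℚ.* (+ m′ ℚ./ suc n′)) ∎)
    where open ℚᵘ.≃-Reasoning

  frac-≤ : ∀ m n m′ n′ .{{_ : ℕ.NonZero n}} .{{_ : ℕ.NonZero n′}} →
           m ℕ.* n′ ℕ.≤ m′ ℕ.* n → + m ℚ./ n ℚ.≤ + m′ ℚ./ n′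
  frac-≤ m (suc n) m′ (suc n′) le = ℚ.toℚᵘ-cancel-≤ (begin
    ℚ.toℚᵘ (+ m ℚ./ suc n)    ≃⟨ ℚ.toℚᵘ-fromℚᵘ (ℚᵘ.mkℚᵘ (+ m) n) ⟩
    ℚᵘ.mkℚᵘ (+ m) n           ≤⟨ ℚᵘ.*≤* (subst₂ ℤ._≤_ (ℤ.pos-* m (suc n′)) (ℤ.pos-* m′ (suc n)) (ℤ.+≤+ le)) ⟩
    ℚᵘ.mkℚᵘ (+ m′) n′         ≃⟨ ℚ.toℚᵘ-fromℚᵘ (ℚᵘ.mkℚᵘ (+ m′) n′) ⟨
    ℚ.toℚᵘ (+ m′ ℚ./ suc n′)  ∎)
    where open ℚᵘ.≤-Reasoning

  ≤-+ʳ : ∀ {x y z} → 0ℚ ℚ.≤ z → x ℚ.≤ y → x ℚ.≤ y ℚ.+ z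
  ≤-+ʳ {x} {y} {z} 0≤z x≤y =
    subst (ℚ._≤ y ℚ.+ z) (ℚ.+-identityʳ x) (ℚ.+-mono-≤ x≤y 0≤z)

  ≤-+ˡ : ∀ {x y z} → 0ℚ ℚ.≤ z → x ℚ.≤ y → x ℚ.≤ z ℚ.+ y
  ≤-+ˡ {x} {y} {z} 0≤z x≤y =
    subst (ℚ._≤ z ℚ.+ y) (ℚ.+-identityˡ x) (ℚ.+-mono-≤ 0≤z x≤y)

module PAdic {p : ℕ} (pr : Prime p) where

  instance
    p≢0 : ℕ.NonZero p
    p≢0 = prime⇒nonZero pr

  private
    instance
      p≢1 : ℕ.NonTrivial p
      p≢1 = prime⇒nonTrivial pr

  largestExponent : ℕ → ℕ → ℕ
  largestExponent n zero    = zero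
  largestExponent n (suc k) with p ℕ.^ suc k ∣? n
  ... | yes _ = suc k
  ... | no  _ = largestExponent n k

  -- The exponent of p in n, for n ≢ 0; it is at most n since n < p ^ n.
  ν : ℕ → ℕ
  ν n = largestExponent n n

  private
    P : ℕ → ℕ
    P n = p ℕ.^ ν n

    P≢0 : ∀ n → ℕ.NonZero (P n)
    P≢0 n = ℕ.m^n≢0 p (ν n)

  -- |a/b| = p ^ (ν b − ν a)
  absFrac : ℕ → ℕ → ℚ
  absFrac zero      b = 0ℚ
  absFrac a@(suc _) b = (+ (p ℕ.^ ν b) ℚ./ (p ℕ.^ ν a)) {{ℕ.m^n≢0 p (ν a)}}

  ∣_∣ₚ : ℚ → ℚ
  ∣ r ∣ₚ = absFrac ℤ.∣ ↥ r ∣ (↧ₙ r)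

  private
    largest-∣ : ∀ n k → p ℕ.^ largestExponent n k ∣ n
    largest-∣ n zero    = ℕᵈ.1∣ n
    largest-∣ n (suc k) with p ℕ.^ suc k ∣? n
    ... | yes d = d
    ... | no  _ = largest-∣ n k

    largest-max : ∀ n k j → j ℕ.≤ k → p ℕ.^ j ∣ n → j ℕ.≤ largestExponent n k
    largest-max n zero    j j≤k d = j≤k
    largest-max n (suc k) j j≤k d with p ℕ.^ suc k ∣? n
    ... | yes _ = j≤k
    ... | no ¬d with ℕ.m≤n⇒m<n∨m≡n j≤k
    ...   | inj₁ (ℕ.s≤s j≤k′) = largest-max n k j j≤k′ d
    ...   | inj₂ refl         = ⊥-elim (¬d d)

    k<p^k : ∀ k → k ℕ.< p ℕ.^ k
    k<p^k zero    = ℕ.≤-refl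
    k<p^k (suc k) = begin-strict
      suc k              ≤⟨ k<p^k k ⟩
      p ℕ.^ k            <⟨ ℕ.m<m*n (p ℕ.^ k) p {{ℕ.m^n≢0 p k}} (ℕ.nonTrivial⇒n>1 p) ⟩
      p ℕ.^ k ℕ.* p      ≡⟨ ℕ.*-comm (p ℕ.^ k) p ⟩
      p ℕ.^ suc k        ∎
      where open ℕ.≤-Reasoning

  p^ν∣n : ∀ n → p ℕ.^ ν n ∣ n
  p^ν∣n n = largest-∣ n n

  p^k∣n⇒k≤ν : ∀ n k .{{_ : ℕ.NonZero n}} → p ℕ.^ k ∣ n → k ℕ.≤ ν n
  p^k∣n⇒k≤ν n k d =
    largest-max n n k (ℕ.≤-trans (ℕ.<⇒≤ (k<p^k k)) (ℕᵈ.∣⇒≤ d)) d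

  private
    p^j∣p^k : ∀ {j k} → j ℕ.≤ k → p ℕ.^ j ∣ p ℕ.^ k
    p^j∣p^k {j} {k} j≤k = divides (p ℕ.^ (k ℕ.∸ j)) (begin
      p ℕ.^ k                            ≡⟨ cong (p ℕ.^_) (ℕ.m∸n+n≡m j≤k) ⟨
      p ℕ.^ (k ℕ.∸ j ℕ.+ j)              ≡⟨ ℕ.^-distribˡ-+-* p (k ℕ.∸ j) j ⟩
      p ℕ.^ (k ℕ.∸ j) ℕ.* p ℕ.^ j        ∎)
      where open ≡-Reasoning

    ∤cofactor : ∀ n m .{{_ : ℕ.NonZero n}} → n ≡ m ℕ.* p ℕ.^ ν n → ¬ p ∣ m
    ∤cofactor n m eq (divides c m≡) =
      ℕ.<-irrefl refl (p^k∣n⇒k≤ν n (suc (ν n)) (divides c (begin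
        n                          ≡⟨ eq ⟩
        m ℕ.* P n                  ≡⟨ cong (ℕ._* P n) m≡ ⟩
        (c ℕ.* p) ℕ.* P n          ≡⟨ ℕ.*-assoc c p (P n) ⟩
        c ℕ.* p ℕ.^ suc (ν n)      ∎)))
      where open ≡-Reasoning

  ν-* : ∀ m n .{{_ : ℕ.NonZero m}} .{{_ : ℕ.NonZero n}} → ν (m ℕ.* n) ≡ ν m ℕ.+ ν n
  ν-* m n with p^ν∣n m | p^ν∣n n
  ... | divides a m≡ | divides b n≡ = ℕ.≤-antisym upper lower
    where
    instance
      mn≢0 : ℕ.NonZero (m ℕ.* n)
      mn≢0 = ℕ.m*n≢0 m n
    mn≡ : m ℕ.* n ≡ (a ℕ.* b) ℕ.* p ℕ.^ (ν m ℕ.+ ν n)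
    mn≡ = begin
      m ℕ.* n                             ≡⟨ cong₂ ℕ._*_ m≡ n≡ ⟩
      (a ℕ.* P m) ℕ.* (b ℕ.* P n)
        ≡⟨ solve 4 (λ a x b y → (a :* x) :* (b :* y) := (a :* b) :* (x :* y)) refl a (P m) b (P n) ⟩
      (a ℕ.* b) ℕ.* (P m ℕ.* P n)         ≡⟨ cong ((a ℕ.* b) ℕ.*_) (ℕ.^-distribˡ-+-* p (ν m) (ν n)) ⟨
      (a ℕ.* b) ℕ.* p ℕ.^ (ν m ℕ.+ ν n)   ∎
      where open ≡-Reasoning
            open ℕSolver.+-*-Solver
    lower : ν m ℕ.+ ν n ℕ.≤ ν (m ℕ.* n)
    lower = p^k∣n⇒k≤ν (m ℕ.* n) (ν m ℕ.+ ν n) (divides (a ℕ.* b) mn≡)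
    upper : ν (m ℕ.* n) ℕ.≤ ν m ℕ.+ ν n
    upper with ν (m ℕ.* n) ℕ.≤? ν m ℕ.+ ν n
    ... | yes le = le
    ... | no ¬le = ⊥-elim (p∤ab p∣ab)
      where
      k = ν m ℕ.+ ν n
      p^1+k∣ : p ℕ.* p ℕ.^ k ∣ (a ℕ.* b) ℕ.* p ℕ.^ k
      p^1+k∣ = subst (p ℕ.^ suc k ∣_) mn≡
        (ℕᵈ.∣-trans (p^j∣p^k (ℕ.≰⇒> ¬le)) (p^ν∣n (m ℕ.* n)))
      p∣ab : p ∣ a ℕ.* b
      p∣ab = ℕᵈ.*-cancelʳ-∣ (p ℕ.^ k) {{ℕ.m^n≢0 p k}} p^1+k∣
      p∤ab : ¬ p ∣ a ℕ.* b
      p∤ab d with euclidsLemma a b pr d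
      ... | inj₁ p∣a = ∤cofactor m a m≡ p∣a
      ... | inj₂ p∣b = ∤cofactor n b n≡ p∣b

  private
    P-* : ∀ m n .{{_ : ℕ.NonZero m}} .{{_ : ℕ.NonZero n}} → P (m ℕ.* n) ≡ P m ℕ.* P n
    P-* m n = trans (cong (p ℕ.^_) (ν-* m n)) (ℕ.^-distribˡ-+-* p (ν m) (ν n))

    absFrac-cong : ∀ a b a′ b′ .{{_ : ℕ.NonZero b}} .{{_ : ℕ.NonZero b′}} →
                   a ℕ.* b′ ≡ a′ ℕ.* b → absFrac a b ≡ absFrac a′ b′
    absFrac-cong zero      b zero       b′ eq = refl
    absFrac-cong zero      b (suc a′)   b′ eq =
      ⊥-elim (ℕ.≢-nonZero⁻¹ (suc a′ ℕ.* b) {{ℕ.m*n≢0 (suc a′) b}} (sym eq))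
    absFrac-cong (suc a)   b zero       b′ eq =
      ⊥-elim (ℕ.≢-nonZero⁻¹ (suc a ℕ.* b′) {{ℕ.m*n≢0 (suc a) b′}} eq)
    absFrac-cong a@(suc _) b a′@(suc _) b′ eq = frac-≡ (P b) (P a) (P b′) (P a′) {{P≢0 a}} {{P≢0 a′}} (begin
      P b ℕ.* P a′     ≡⟨ ℕ.*-comm (P b) (P a′) ⟩
      P a′ ℕ.* P b     ≡⟨ P-* a′ b ⟨
      P (a′ ℕ.* b)     ≡⟨ cong P eq ⟨
      P (a ℕ.* b′)     ≡⟨ P-* a b′ ⟩
      P a ℕ.* P b′     ≡⟨ ℕ.*-comm (P a) (P b′) ⟩
      P b′ ℕ.* P a     ∎)
      where open ≡-Reasoning

    absFrac-* : ∀ a b c d .{{_ : ℕ.NonZero b}} .{{_ : ℕ.NonZero d}} →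
                absFrac (a ℕ.* c) (b ℕ.* d) ≡ absFrac a b ℚ.* absFrac c d
    absFrac-* zero      b c         d = sym (ℚ.*-zeroˡ (absFrac c d))
    absFrac-* a@(suc _) b zero      d = trans
      (cong (λ z → absFrac z (b ℕ.* d)) (ℕ.*-zeroʳ a)) (sym (ℚ.*-zeroʳ (absFrac a b)))
    absFrac-* a@(suc _) b c@(suc _) d = trans
      (frac-≡ (P (b ℕ.* d)) (P (a ℕ.* c)) (P b ℕ.* P d) (P a ℕ.* P c) {{P≢0 (a ℕ.* c)}}
        (cong₂ ℕ._*_ (P-* b d) (sym (P-* a c))))
      (frac-* (P b) (P a) (P d) (P c) {{P≢0 a}} {{P≢0 c}})
      where
      instance
        PaPc≢0 : ℕ.NonZero (P a ℕ.* P c)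
        PaPc≢0 = ℕ.m*n≢0 (P a) (P c) {{P≢0 a}} {{P≢0 c}}

    ∣∣ₚ-rep : ∀ r x → ℚ.toℚᵘ r ℚᵘ.≃ x → ∣ r ∣ₚ ≡ absFrac ℤ.∣ ℚᵘ.↥ x ∣ (ℚᵘ.↧ₙ x)
    ∣∣ₚ-rep (ℚ.mkℚ n d _) x@record{} (ℚᵘ.*≡* eq) =
      absFrac-cong ℤ.∣ n ∣ (suc d) ℤ.∣ ℚᵘ.↥ x ∣ (ℚᵘ.↧ₙ x) (begin
        ℤ.∣ n ∣ ℕ.* ℚᵘ.↧ₙ x        ≡⟨ ℤ.abs-* n (ℚᵘ.↧ x) ⟨
        ℤ.∣ n ℤ.* ℚᵘ.↧ x ∣         ≡⟨ cong ℤ.∣_∣ eq ⟩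
        ℤ.∣ ℚᵘ.↥ x ℤ.* + suc d ∣   ≡⟨ ℤ.abs-* (ℚᵘ.↥ x) (+ suc d) ⟩
        ℤ.∣ ℚᵘ.↥ x ∣ ℕ.* suc d     ∎)
      where open ≡-Reasoning

  0≤∣_∣ₚ : ∀ r → 0ℚ ℚ.≤ ∣ r ∣ₚ
  0≤∣ ℚ.mkℚ n d _ ∣ₚ with ℤ.∣ n ∣
  ... | zero      = ℚ.≤-refl
  ... | a@(suc _) = frac-≤ 0 1 (P (suc d)) (P a) {{_}} {{P≢0 a}} ℕ.z≤n

  private
    absFrac≡0 : ∀ a b → absFrac a b ≡ 0ℚ → a ≡ 0
    absFrac≡0 zero      b eq = refl
    absFrac≡0 a@(suc _) b eq = ⊥-elim (ℚ.<⇒≢ (ℚ.positive⁻¹ (absFrac a b)) (sym eq))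
      where
      instance
        positive : ℚ.Positive (absFrac a b)
        positive = ℚ.normalize-pos (P b) (P a) {{P≢0 a}} {{P≢0 b}}

  ∣r∣ₚ≡0⇒r≡0 : ∀ r → ∣ r ∣ₚ ≡ 0ℚ → r ≡ 0ℚ
  ∣r∣ₚ≡0⇒r≡0 r eq =
    ℚ.↥p≡0⇒p≡0 r (ℤ.∣i∣≡0⇒i≡0 (absFrac≡0 ℤ.∣ ↥ r ∣ (↧ₙ r) eq))

  ∣x*y∣ₚ : ∀ x y → ∣ x ℚ.* y ∣ₚ ≡ ∣ x ∣ₚ ℚ.* ∣ y ∣ₚ
  ∣x*y∣ₚ x@record{} y@record{} = begin
    ∣ x ℚ.* y ∣ₚ
      ≡⟨ ∣∣ₚ-rep (x ℚ.* y) _ (ℚ.toℚᵘ-homo-* x y) ⟩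
    absFrac ℤ.∣ ↥ x ℤ.* ↥ y ∣ (↧ₙ x ℕ.* ↧ₙ y)
      ≡⟨ cong (λ z → absFrac z (↧ₙ x ℕ.* ↧ₙ y)) (ℤ.abs-* (↥ x) (↥ y)) ⟩
    absFrac (ℤ.∣ ↥ x ∣ ℕ.* ℤ.∣ ↥ y ∣) (↧ₙ x ℕ.* ↧ₙ y)
      ≡⟨ absFrac-* ℤ.∣ ↥ x ∣ (↧ₙ x) ℤ.∣ ↥ y ∣ (↧ₙ y) ⟩
    ∣ x ∣ₚ ℚ.* ∣ y ∣ₚ ∎
    where open ≡-Reasoning

  private
    ∣-sum : ∀ k i j → k ∣ ℤ.∣ i ∣ → k ∣ ℤ.∣ j ∣ → k ∣ ℤ.∣ i ℤ.+ j ∣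
    ∣-sum k i j k∣i k∣j = ℤˢ.∣⇒∣ᵤ {+ k} {i ℤ.+ j}
      (ℤˢ.∣m∣n⇒∣m+n (ℤˢ.∣ᵤ⇒∣ {+ k} {i} k∣i) (ℤˢ.∣ᵤ⇒∣ {+ k} {j} k∣j))

    -- If p ^ ν (a * d) divides e, then |e/(b*d)| ≤ |(a*d)/(b*d)| = |a/b|.
    absFrac-≤ : ∀ e a b d .{{_ : ℕ.NonZero a}} .{{_ : ℕ.NonZero b}} .{{_ : ℕ.NonZero d}} →
                P (a ℕ.* d) ∣ e → absFrac e (b ℕ.* d) ℚ.≤ absFrac a b
    absFrac-≤ zero      a@(suc _) b d _  = frac-≤ 0 1 (P b) (P a) {{_}} {{P≢0 a}} ℕ.z≤n
    absFrac-≤ e@(suc _) a@(suc _) b d Pad∣e = frac-≤ (P (b ℕ.* d)) (P e) (P b) (P a) {{P≢0 e}} {{P≢0 a}} (begin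
      P (b ℕ.* d) ℕ.* P a          ≡⟨ cong (ℕ._* P a) (P-* b d) ⟩
      P b ℕ.* P d ℕ.* P a          ≡⟨ ℕ.*-assoc (P b) (P d) (P a) ⟩
      P b ℕ.* (P d ℕ.* P a)        ≡⟨ cong (P b ℕ.*_) (ℕ.*-comm (P d) (P a)) ⟩
      P b ℕ.* (P a ℕ.* P d)        ≡⟨ cong (P b ℕ.*_) (P-* a d) ⟨
      P b ℕ.* P (a ℕ.* d)          ≤⟨ ℕ.*-monoʳ-≤ (P b) (ℕ.^-monoʳ-≤ p (p^k∣n⇒k≤ν e (ν (a ℕ.* d)) Pad∣e)) ⟩
      P b ℕ.* P e                  ∎)
      where open ℕ.≤-Reasoning

    ∣↥∣≢0 : ∀ {r} → r ≢ 0ℚ → ℕ.NonZero ℤ.∣ ↥ r ∣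
    ∣↥∣≢0 {r} r≢0 = ℕ.≢-nonZero (λ eq → r≢0 (ℚ.↥p≡0⇒p≡0 r (ℤ.∣i∣≡0⇒i≡0 eq)))

  ∣x+y∣ₚ-ultra : ∀ x y → ∣ x ℚ.+ y ∣ₚ ℚ.≤ ∣ x ∣ₚ ⊎ ∣ x ℚ.+ y ∣ₚ ℚ.≤ ∣ y ∣ₚ
  ∣x+y∣ₚ-ultra x@record{} y@record{} with x ℚ.≟ 0ℚ | y ℚ.≟ 0ℚ
  ... | yes x≡0 | _ =
    inj₂ (ℚ.≤-reflexive (cong ∣_∣ₚ (trans (cong (ℚ._+ y) x≡0) (ℚ.+-identityˡ y))))
  ... | no _ | yes y≡0 =
    inj₁ (ℚ.≤-reflexive (cong ∣_∣ₚ (trans (cong (x ℚ.+_) y≡0) (ℚ.+-identityʳ x))))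
  ... | no x≢0 | no y≢0 = result
    where
    a = ℤ.∣ ↥ x ∣
    b = ↧ₙ x
    c = ℤ.∣ ↥ y ∣
    d = ↧ₙ y
    e = ℤ.∣ ↥ x ℤ.* ↧ y ℤ.+ ↥ y ℤ.* ↧ x ∣
    instance
      a≢0 : ℕ.NonZero a
      a≢0 = ∣↥∣≢0 {x} x≢0
      c≢0 : ℕ.NonZero c
      c≢0 = ∣↥∣≢0 {y} y≢0
    sum≡ : ∣ x ℚ.+ y ∣ₚ ≡ absFrac e (b ℕ.* d)
    sum≡ = ∣∣ₚ-rep (x ℚ.+ y) _ (ℚ.toℚᵘ-homo-+ x y)
    e-div : ∀ k → k ∣ a ℕ.* d → k ∣ c ℕ.* b → k ∣ e
    e-div k k∣ad k∣cb = ∣-sum k (↥ x ℤ.* ↧ y) (↥ y ℤ.* ↧ x)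
      (subst (k ∣_) (sym (ℤ.abs-* (↥ x) (↧ y))) k∣ad)
      (subst (k ∣_) (sym (ℤ.abs-* (↥ y) (↧ x))) k∣cb)
    result : ∣ x ℚ.+ y ∣ₚ ℚ.≤ ∣ x ∣ₚ ⊎ ∣ x ℚ.+ y ∣ₚ ℚ.≤ ∣ y ∣ₚ
    result with ℕ.≤-total (ν (a ℕ.* d)) (ν (c ℕ.* b))
    ... | inj₁ le = inj₁ (subst (ℚ._≤ ∣ x ∣ₚ) (sym sum≡)
      (absFrac-≤ e a b d (e-div (P (a ℕ.* d)) (p^ν∣n (a ℕ.* d)) (ℕᵈ.∣-trans (p^j∣p^k le) (p^ν∣n (c ℕ.* b))))))
    ... | inj₂ le = inj₂ (subst (ℚ._≤ ∣ y ∣ₚ)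
      (sym (trans sum≡ (cong (absFrac e) (ℕ.*-comm b d))))
      (absFrac-≤ e c d b (e-div (P (c ℕ.* b)) (ℕᵈ.∣-trans (p^j∣p^k le) (p^ν∣n (a ℕ.* d))) (p^ν∣n (c ℕ.* b)))))

  ∣x+y∣ₚ≤ : ∀ x y → ∣ x ℚ.+ y ∣ₚ ℚ.≤ ∣ x ∣ₚ ℚ.+ ∣ y ∣ₚ
  ∣x+y∣ₚ≤ x y with ∣x+y∣ₚ-ultra x y
  ... | inj₁ le = ≤-+ʳ 0≤∣ y ∣ₚ le
  ... | inj₂ le = ≤-+ˡ 0≤∣ x ∣ₚ le

p-adic : ∀ {p} → Prime p → AbsoluteValue
p-adic pr = record
  { ∣_∣       = ∣_∣ₚ
  ; 0≤∣_∣     = 0≤∣_∣ₚ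
  ; ∣0∣≡0     = refl
  ; ∣x∣≡0⇒x≡0 = ∣r∣ₚ≡0⇒r≡0
  ; ∣x*y∣     = ∣x*y∣ₚ
  ; ∣x+y∣≤    = ∣x+y∣ₚ≤
  }
  where open PAdic pr

Eventually : (ℕ → Set) → Set
Eventually P = ∃ λ K → ∀ n → K ℕ.≤ n → P n

IsCauchy : AbsoluteValue → (ℕ → ℚ) → Set
IsCauchy v s = ∀ ε → 0ℚ ℚ.< ε →
  ∃ λ K → ∀ m n → K ℕ.≤ m → K ℕ.≤ n → ∣ s m ℚ.- s n ∣ ℚ.< ε
  where open AbsoluteValue v

-- No quotient is taken: the equality of the completion is _≈_ below.
record Completion (v : AbsoluteValue) : Set where
  constructor _because_
  field
    seq    : ℕ → ℚ
    cauchy : IsCauchy v seq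

open Completion public

ℝ : Set
ℝ = Completion usual

ℚₚ : ∀ {p} → Prime p → Set
ℚₚ pr = Completion (p-adic pr)

private
  open ℚSolver.+-*-Solver

  0<+ : ∀ {A B} → 0ℚ ℚ.< A → 0ℚ ℚ.< B → 0ℚ ℚ.< A ℚ.+ B
  0<+ {A} {B} 0<A 0<B = ℚ.+-mono-< {0ℚ} {A} {0ℚ} {B} 0<A 0<B

  0<½ε : ∀ {ε} → 0ℚ ℚ.< ε → 0ℚ ℚ.< ½ ℚ.* ε
  0<½ε {ε} 0<ε = subst (ℚ._< ½ ℚ.* ε) (ℚ.*-zeroʳ ½) (ℚ.*-monoʳ-<-pos ½ 0<ε)

  ½ε+½ε : ∀ ε → ½ ℚ.* ε ℚ.+ ½ ℚ.* ε ≡ ε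
  ½ε+½ε ε = trans (sym (ℚ.*-distribʳ-+ ε ½ ½)) (ℚ.*-identityˡ ε)

  shrink : ∀ C ζ → 0ℚ ℚ.< C → 0ℚ ℚ.< ζ → ∃ λ η → 0ℚ ℚ.< η × C ℚ.* η ≡ ζ
  shrink C ζ 0<C 0<ζ =
      ℚ.1/ C ℚ.* ζ
    , subst (ℚ._< ℚ.1/ C ℚ.* ζ) (ℚ.*-zeroʳ (ℚ.1/ C)) (ℚ.*-monoʳ-<-pos (ℚ.1/ C) 0<ζ)
    , trans (sym (ℚ.*-assoc C (ℚ.1/ C) ζ))
        (trans (cong (ℚ._* ζ) (ℚ.*-inverseʳ C)) (ℚ.*-identityˡ ζ))
    where
    instance
      C-pos : ℚ.Positive C
      C-pos = ℚ.positive 0<C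
      C≢0 : ℚ.NonZero C
      C≢0 = ℚ.pos⇒nonZero C
      1/C-pos : ℚ.Positive (ℚ.1/ C)
      1/C-pos = ℚ.1/pos⇒pos C

module _ (v : AbsoluteValue) where
  open AbsoluteValue v

  const-cauchy : ∀ r → IsCauchy v (λ _ → r)
  const-cauchy r ε 0<ε = 0 , λ _ _ _ _ →
    subst (ℚ._< ε) (sym (trans (cong ∣_∣ (ℚ.+-inverseʳ r)) ∣0∣≡0)) 0<ε

  +-cauchy : ∀ s t → IsCauchy v s → IsCauchy v t → IsCauchy v (λ n → s n ℚ.+ t n)
  +-cauchy s t cs ct ε 0<ε with cs (½ ℚ.* ε) (0<½ε 0<ε) | ct (½ ℚ.* ε) (0<½ε 0<ε)
  ... | K , hs | L , ht = K ℕ.⊔ L , λ m n m≥ n≥ → begin-strict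
    ∣ (s m ℚ.+ t m) ℚ.- (s n ℚ.+ t n) ∣
      ≡⟨ cong ∣_∣ (solve 4 (λ a b c d → (a :+ b) :- (c :+ d) := (a :- c) :+ (b :- d))
                         refl (s m) (t m) (s n) (t n)) ⟩
    ∣ (s m ℚ.- s n) ℚ.+ (t m ℚ.- t n) ∣
      ≤⟨ ∣x+y∣≤ (s m ℚ.- s n) (t m ℚ.- t n) ⟩
    ∣ s m ℚ.- s n ∣ ℚ.+ ∣ t m ℚ.- t n ∣
      <⟨ ℚ.+-mono-< (hs m n (ℕ.m⊔n≤o⇒m≤o K L m≥) (ℕ.m⊔n≤o⇒m≤o K L n≥))
                    (ht m n (ℕ.m⊔n≤o⇒n≤o K L m≥) (ℕ.m⊔n≤o⇒n≤o K L n≥)) ⟩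
    ½ ℚ.* ε ℚ.+ ½ ℚ.* ε
      ≡⟨ ½ε+½ε ε ⟩
    ε ∎
    where open ℚ.≤-Reasoning

  neg-cauchy : ∀ s → IsCauchy v s → IsCauchy v (λ n → ℚ.- s n)
  neg-cauchy s cs ε 0<ε with cs ε 0<ε
  ... | K , h = K , λ m n m≥ n≥ → subst (λ z → ∣ z ∣ ℚ.< ε)
    (solve 2 (λ a b → b :- a := (:- a) :- (:- b)) refl (s m) (s n)) (h n m n≥ m≥)

  Bounded : (ℕ → ℚ) → Set
  Bounded s = ∃ λ B → 0ℚ ℚ.< B × Eventually (λ n → ∣ s n ∣ ℚ.≤ B)

  cauchy-bounded : ∀ s → IsCauchy v s → Bounded s
  cauchy-bounded s cs with cs 1ℚ (ℚ.positive⁻¹ 1ℚ)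
  ... | K , h = 1ℚ ℚ.+ ∣ s K ∣
              , ℚ.+-mono-<-≤ (ℚ.positive⁻¹ 1ℚ) 0≤∣ s K ∣
              , K , λ n n≥ → begin
    ∣ s n ∣                       ≡⟨ cong ∣_∣ (solve 2 (λ a b → a := (a :- b) :+ b) refl (s n) (s K)) ⟩
    ∣ (s n ℚ.- s K) ℚ.+ s K ∣     ≤⟨ ∣x+y∣≤ (s n ℚ.- s K) (s K) ⟩
    ∣ s n ℚ.- s K ∣ ℚ.+ ∣ s K ∣   ≤⟨ ℚ.+-monoˡ-≤ ∣ s K ∣ (ℚ.<⇒≤ (h n K n≥ ℕ.≤-refl)) ⟩
    1ℚ ℚ.+ ∣ s K ∣                ∎
    where open ℚ.≤-Reasoning

  private
    product-< : ∀ {C η ζ} x y .{{_ : ℚ.Positive C}} → C ℚ.* η ≡ ζ →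
                ∣ x ∣ ℚ.≤ C → ∣ y ∣ ℚ.< η → ∣ x ℚ.* y ∣ ℚ.< ζ
    product-< {C} {η} {ζ} x y Cη≡ζ x≤ y< = begin-strict
      ∣ x ℚ.* y ∣        ≡⟨ ∣x*y∣ x y ⟩
      ∣ x ∣ ℚ.* ∣ y ∣    ≤⟨ ℚ.*-monoʳ-≤-nonNeg ∣ y ∣ {{ℚ.nonNegative 0≤∣ y ∣}} x≤ ⟩
      C ℚ.* ∣ y ∣        <⟨ ℚ.*-monoʳ-<-pos C y< ⟩
      C ℚ.* η            ≡⟨ Cη≡ζ ⟩
      ζ                  ∎
      where open ℚ.≤-Reasoning

    product-difference : ∀ a b c d →
      ∣ a ℚ.* b ℚ.- c ℚ.* d ∣ ℚ.≤ ∣ a ℚ.* (b ℚ.- d) ∣ ℚ.+ ∣ d ℚ.* (a ℚ.- c) ∣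
    product-difference a b c d = begin
      ∣ a ℚ.* b ℚ.- c ℚ.* d ∣
        ≡⟨ cong ∣_∣ (solve 4 (λ a b c d → a :* b :- c :* d := a :* (b :- d) :+ d :* (a :- c))
                           refl a b c d) ⟩
      ∣ a ℚ.* (b ℚ.- d) ℚ.+ d ℚ.* (a ℚ.- c) ∣
        ≤⟨ ∣x+y∣≤ (a ℚ.* (b ℚ.- d)) (d ℚ.* (a ℚ.- c)) ⟩
      ∣ a ℚ.* (b ℚ.- d) ∣ ℚ.+ ∣ d ℚ.* (a ℚ.- c) ∣ ∎
      where open ℚ.≤-Reasoning

    product-close : ∀ {A B η ε} x x′ y y′ → 0ℚ ℚ.< A → 0ℚ ℚ.< B →
                    (A ℚ.+ B) ℚ.* η ≡ ½ ℚ.* ε → ∣ x ∣ ℚ.≤ A → ∣ y′ ∣ ℚ.≤ B →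
                    ∣ x ℚ.- x′ ∣ ℚ.< η → ∣ y ℚ.- y′ ∣ ℚ.< η →
                    ∣ x ℚ.* y ℚ.- x′ ℚ.* y′ ∣ ℚ.< ε
    product-close {A} {B} {η} {ε} x x′ y y′ 0<A 0<B eq x≤A y′≤B x-x′<η y-y′<η =
      ℚ.≤-<-trans (product-difference x y x′ y′)
        (subst (∣ u ∣ ℚ.+ ∣ w ∣ ℚ.<_) (½ε+½ε ε)
          (ℚ.+-mono-< {∣ u ∣} {½ ℚ.* ε} {∣ w ∣} {½ ℚ.* ε}
            (product-< {A ℚ.+ B} {η} x (y ℚ.- y′) eq
              (≤-+ʳ {∣ x ∣} {A} {B} (ℚ.<⇒≤ 0<B) x≤A) y-y′<η)
            (product-< {A ℚ.+ B} {η} y′ (x ℚ.- x′) eq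
              (≤-+ˡ {∣ y′ ∣} {B} {A} (ℚ.<⇒≤ 0<A) y′≤B) x-x′<η)))
      where
      u = x ℚ.* (y ℚ.- y′)
      w = y′ ℚ.* (x ℚ.- x′)
      instance
        A+B-pos : ℚ.Positive (A ℚ.+ B)
        A+B-pos = ℚ.positive (0<+ {A} {B} 0<A 0<B)

  *-cauchy : ∀ s t → IsCauchy v s → IsCauchy v t → IsCauchy v (λ n → s n ℚ.* t n)
  *-cauchy s t cs ct ε 0<ε = go (cauchy-bounded s cs) (cauchy-bounded t ct)
    where
    go : Bounded s → Bounded t → ∃ λ M → ∀ m n → M ℕ.≤ m → M ℕ.≤ n →
         ∣ s m ℚ.* t m ℚ.- s n ℚ.* t n ∣ ℚ.< ε
    go (A , 0<A , I , s≤A) (B , 0<B , J , t≤B) =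
      let η , 0<η , eq = shrink (A ℚ.+ B) (½ ℚ.* ε) (0<+ {A} {B} 0<A 0<B) (0<½ε {ε} 0<ε)
          K , s-close = cs η 0<η
          L , t-close = ct η 0<η
      in (K ℕ.⊔ L) ℕ.⊔ (I ℕ.⊔ J) , λ m n m≥ n≥ →
        let m≥KL = ℕ.m⊔n≤o⇒m≤o (K ℕ.⊔ L) (I ℕ.⊔ J) m≥
            n≥KL = ℕ.m⊔n≤o⇒m≤o (K ℕ.⊔ L) (I ℕ.⊔ J) n≥
            m≥IJ = ℕ.m⊔n≤o⇒n≤o (K ℕ.⊔ L) (I ℕ.⊔ J) m≥
            n≥IJ = ℕ.m⊔n≤o⇒n≤o (K ℕ.⊔ L) (I ℕ.⊔ J) n≥
        in product-close {A} {B} {η} {ε} (s m) (s n) (t m) (t n) 0<A 0<B eq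
             (s≤A m (ℕ.m⊔n≤o⇒m≤o I J m≥IJ)) (t≤B n (ℕ.m⊔n≤o⇒n≤o I J n≥IJ))
             (s-close m n (ℕ.m⊔n≤o⇒m≤o K L m≥KL) (ℕ.m⊔n≤o⇒m≤o K L n≥KL))
             (t-close m n (ℕ.m⊔n≤o⇒n≤o K L m≥KL) (ℕ.m⊔n≤o⇒n≤o K L n≥KL))

  private
    ∣a∣-∣b∣≤∣a-b∣ : ∀ a b → ∣ a ∣ ℚ.- ∣ b ∣ ℚ.≤ ∣ a ℚ.- b ∣
    ∣a∣-∣b∣≤∣a-b∣ a b = begin
      ∣ a ∣ ℚ.- ∣ b ∣
        ≡⟨ cong (λ z → ∣ z ∣ ℚ.- ∣ b ∣) (solve 2 (λ a b → a := (a :- b) :+ b) refl a b) ⟩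
      ∣ (a ℚ.- b) ℚ.+ b ∣ ℚ.- ∣ b ∣
        ≤⟨ ℚ.+-monoˡ-≤ (ℚ.- ∣ b ∣) (∣x+y∣≤ (a ℚ.- b) b) ⟩
      (∣ a ℚ.- b ∣ ℚ.+ ∣ b ∣) ℚ.- ∣ b ∣
        ≡⟨ solve 2 (λ x y → (x :+ y) :- y := x) refl ∣ a ℚ.- b ∣ ∣ b ∣ ⟩
      ∣ a ℚ.- b ∣ ∎
      where open ℚ.≤-Reasoning

    abs-< : ∀ x y ε → x ℚ.- y ℚ.< ε → y ℚ.- x ℚ.< ε → ℚ.∣ x ℚ.- y ∣ ℚ.< ε
    abs-< x y ε p q with ℚ.∣p∣≡p∨∣p∣≡-p (x ℚ.- y)
    ... | inj₁ eq = subst (ℚ._< ε) (sym eq) p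
    ... | inj₂ eq = subst (ℚ._< ε)
      (sym (trans eq (solve 2 (λ x y → :- (x :- y) := y :- x) refl x y))) q

  abs-cauchy : ∀ s → IsCauchy v s → IsCauchy usual (λ n → ∣ s n ∣)
  abs-cauchy s cs ε 0<ε with cs ε 0<ε
  ... | K , h = K , λ m n m≥ n≥ → abs-< ∣ s m ∣ ∣ s n ∣ ε
    (ℚ.≤-<-trans (∣a∣-∣b∣≤∣a-b∣ (s m) (s n)) (h m n m≥ n≥))
    (ℚ.≤-<-trans (∣a∣-∣b∣≤∣a-b∣ (s n) (s m)) (h n m n≥ m≥))

module _ {v : AbsoluteValue} where
  open AbsoluteValue v

  infix  4 _≈_ _≉_
  infix  8 -_
  infixl 6 _+_ _-_
  infixl 7 _*_
  infixr 8 _^_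

  _≈_ : Completion v → Completion v → Set
  x ≈ y = ∀ ε → 0ℚ ℚ.< ε → Eventually (λ n → ∣ seq x n ℚ.- seq y n ∣ ℚ.< ε)

  _≉_ : Completion v → Completion v → Set
  x ≉ y = ¬ x ≈ y

  ι : ℚ → Completion v
  ι r = (λ _ → r) because const-cauchy v r

  _+_ : Completion v → Completion v → Completion v
  x + y = (λ n → seq x n ℚ.+ seq y n) because +-cauchy v (seq x) (seq y) (cauchy x) (cauchy y)

  -_ : Completion v → Completion v
  - x = (λ n → ℚ.- seq x n) because neg-cauchy v (seq x) (cauchy x)

  _-_ : Completion v → Completion v → Completion v
  x - y = x + (- y)

  _*_ : Completion v → Completion v → Completion v
  x * y = (λ n → seq x n ℚ.* seq y n) because *-cauchy v (seq x) (seq y) (cauchy x) (cauchy y)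

  _^_ : Completion v → ℕ → Completion v
  x ^ zero  = ι 1ℚ
  x ^ suc n = x * x ^ n

  ∥_∥ : Completion v → ℝ
  ∥ x ∥ = (λ n → ∣ seq x n ∣) because abs-cauchy v (seq x) (cauchy x)

infix 4 _<ℝ_
_<ℝ_ : ℝ → ℝ → Set
x <ℝ y = ∃ λ η → 0ℚ ℚ.< η × Eventually (λ n → seq x n ℚ.+ η ℚ.≤ seq y n)

module _ {v : AbsoluteValue} where

  Converges : (ℕ → Completion v) → Completion v → Set
  Converges s L = (ε : ℝ) → ι 0ℚ <ℝ ε → Eventually (λ n → ∥ s n - L ∥ <ℝ ε)

  partialSum : (ℕ → Completion v) → ℕ → Completion v
  partialSum f zero    = ι 0ℚ
  partialSum f (suc k) = partialSum f k + f k

  HasSum : (ℕ → Completion v) → Completion v → Set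
  HasSum f = Converges (partialSum f)

-- (a)ₖ = a (a + 1) ⋯ (a + k − 1)
pochhammer : ℕ → ℕ → ℕ
pochhammer a zero    = 1
pochhammer a (suc k) = pochhammer a k ℕ.* (a ℕ.+ k)

-- Exponents such as m − 1 are integers: m = 0 occurs in the series, and there
-- (pochhammer 1 γ) ^ (−1) differs from what truncated subtraction would give.
infixr 8 _^ℤ_
_^ℤ_ : (b : ℕ) .{{_ : ℕ.NonZero b}} → ℤ → ℚ
b ^ℤ (+ k)    = + (b ℕ.^ k) ℚ./ 1
b ^ℤ -[1+ k ] = (+ 1 ℚ./ (b ℕ.^ suc k)) {{ℕ.m^n≢0 b (suc k)}}

pochhammer≢0 : ∀ a k → ℕ.NonZero (pochhammer (suc a) k)
pochhammer≢0 a zero    = _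
pochhammer≢0 a (suc k) =
  ℕ.m*n≢0 (pochhammer (suc a) k) (suc a ℕ.+ k) {{pochhammer≢0 a k}}

module _ (q : ℚ) .{{_ : ℚ.Positive q}} (γ δ N : ℕ) where

  denom : ℕ → ℚ
  denom m = q ℚ.+ + ((m !) ℕ.^ (N ℕ.* m)) ℚ./ 1

  denom≢0 : ∀ m → ℚ.NonZero (denom m)
  denom≢0 m = ℚ.pos⇒nonZero (denom m)
    {{ℚ.pos+nonNeg⇒pos q (+ k ℚ./ 1) {{ℚ.normalize-nonNeg k 1}}}}
    where k = (m !) ℕ.^ (N ℕ.* m)

  summand : ∀ {v} → Completion v → ℕ → Completion v
  summand x n =
    ι ((m !) ^ℤ (+ m ℤ.- + 1)) * x ^ (γ ℕ.* n) *
      ( ι ((+ ((m′ !) ℕ.^ γ) ℚ./ 1) ℚ.* pochhammer (suc m) γ ^ℤ (+ m ℤ.- + 1)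
             ℚ.÷ denom m′) * x ^ γ
      - ι (1ℚ ℚ.÷ denom m))
    where
    m  = γ ℕ.* n ℕ.+ δ
    m′ = γ ℕ.* suc n ℕ.+ δ
    instance
      _ = m ℕ.!≢0
      _ = pochhammer≢0 m γ
      _ = denom≢0 m
      _ = denom≢0 m′

  total : ℚ
  total = ℚ.- ((δ !) ^ℤ (+ δ ℤ.- + 1) ℚ.÷ denom δ)
    where
    instance
      _ = δ ℕ.!≢0
      _ = denom≢0 δ

{-# OPTIONS --safe #-}

-- With m = γ n + δ and T n = (m !) ^ (m − 1) x ^ (γ n) / (q + (m !) ^ (N m)), the
-- n-th summand is T (n + 1) − T n and the claimed sum is − T 0, so everything
-- rests on T n → 0. Over ℝ the coefficient of T n is at most 1 / m !; over ℚₚ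
-- the denominator tends to q, and |m !| ^ (m − 1) decays since |m !| → 0. In
-- both cases the ratio of consecutive bounds tends to 0, which beats |x| ^ (γ n).

module Submission where

open import Defs
open import Algebra.Bundles using (CommutativeRing)
import Algebra.Properties.CommutativeSemiring.Exp as Exp
open import Data.Integer.Base as ℤ using (+_)
import Data.Integer.Properties as ℤ
open import Data.Nat.Base as ℕ using (ℕ; zero; suc; NonZero; _!)
import Data.Nat.Coprimality as Coprime
import Data.Nat.Divisibility as ℕᵈ
open import Data.Nat.Primality using (Prime; prime⇒nonTrivial)
import Data.Nat.Properties as ℕ
open import Data.Product.Base using (∃; _×_; _,_)
open import Data.Rational.Base as ℚ using (ℚ; 0ℚ; 1ℚ; ½; Positive)
import Data.Rational.Properties as ℚ
import Data.Rational.Solver as ℚSolver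
open import Data.Sum.Base using (inj₁; inj₂)
open import Relation.Binary.PropositionalEquality

open ℚSolver.+-*-Solver
open Exp (CommutativeRing.commutativeSemiring ℚ.+-*-commutativeRing)
  using (^-homo-*; ^-distrib-*; ^-congˡ) renaming (_^_ to infixr 8 _^ℚ_)

-- Ordered-field arithmetic in the rationals.

*-cancelʳ-≡ : ∀ {p q} r .{{_ : Positive r}} → p ℚ.* r ≡ q ℚ.* r → p ≡ q
*-cancelʳ-≡ r eq = ℚ.≤-antisym
  (ℚ.*-cancelʳ-≤-pos r (ℚ.≤-reflexive eq))
  (ℚ.*-cancelʳ-≤-pos r (ℚ.≤-reflexive (sym eq)))

*-pos : ∀ {p q} → 0ℚ ℚ.< p → 0ℚ ℚ.< q → 0ℚ ℚ.< p ℚ.* q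
*-pos {p} {q} 0<p 0<q = ℚ.positive⁻¹ (p ℚ.* q)
  {{ℚ.pos*pos⇒pos p {{ℚ.positive 0<p}} q {{ℚ.positive 0<q}}}}

*-nonNeg : ∀ {p q} → 0ℚ ℚ.≤ p → 0ℚ ℚ.≤ q → 0ℚ ℚ.≤ p ℚ.* q
*-nonNeg {p} {q} 0≤p 0≤q = ℚ.nonNegative⁻¹ (p ℚ.* q)
  {{ℚ.nonNeg*nonNeg⇒nonNeg p {{ℚ.nonNegative 0≤p}} q {{ℚ.nonNegative 0≤q}}}}

*-mono-≤-nonNeg : ∀ {p p′ q q′} → 0ℚ ℚ.≤ q → 0ℚ ℚ.≤ p′ →
                  p ℚ.≤ p′ → q ℚ.≤ q′ → p ℚ.* q ℚ.≤ p′ ℚ.* q′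
*-mono-≤-nonNeg {p} {p′} {q} {q′} 0≤q 0≤p′ p≤p′ q≤q′ = ℚ.≤-trans
  (ℚ.*-monoʳ-≤-nonNeg q {{ℚ.nonNegative 0≤q}} p≤p′)
  (ℚ.*-monoˡ-≤-nonNeg p′ {{ℚ.nonNegative 0≤p′}} q≤q′)

quotient : ∀ ε C → 0ℚ ℚ.< ε → 0ℚ ℚ.< C → ∃ λ η → 0ℚ ℚ.< η × C ℚ.* η ≡ ε
quotient ε C 0<ε 0<C =
    ℚ.1/ C ℚ.* ε
  , *-pos (ℚ.positive⁻¹ (ℚ.1/ C) {{ℚ.1/pos⇒pos C}}) 0<ε
  , (begin
      C ℚ.* (ℚ.1/ C ℚ.* ε)  ≡⟨ ℚ.*-assoc C (ℚ.1/ C) ε ⟨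
      C ℚ.* ℚ.1/ C ℚ.* ε    ≡⟨ cong (ℚ._* ε) (ℚ.*-inverseʳ C) ⟩
      1ℚ ℚ.* ε              ≡⟨ ℚ.*-identityˡ ε ⟩
      ε                     ∎)
  where
  open ≡-Reasoning
  instance
    C-pos : Positive C
    C-pos = ℚ.positive 0<C
    C≢0 : ℚ.NonZero C
    C≢0 = ℚ.pos⇒nonZero C

÷-cancel : ∀ p q .{{_ : ℚ.NonZero q}} → p ℚ.÷ q ℚ.* q ≡ p
÷-cancel p q = begin
  p ℚ.* ℚ.1/ q ℚ.* q    ≡⟨ ℚ.*-assoc p (ℚ.1/ q) q ⟩
  p ℚ.* (ℚ.1/ q ℚ.* q)  ≡⟨ cong (p ℚ.*_) (ℚ.*-inverseˡ q) ⟩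
  p ℚ.* 1ℚ              ≡⟨ ℚ.*-identityʳ p ⟩
  p                     ∎
  where open ≡-Reasoning

0<½ : 0ℚ ℚ.< ½
0<½ = ℚ.positive⁻¹ ½

½*p+½*p≡p : ∀ p → ½ ℚ.* p ℚ.+ ½ ℚ.* p ≡ p
½*p+½*p≡p p = trans (sym (ℚ.*-distribʳ-+ p ½ ½)) (ℚ.*-identityˡ p)

^ℚ-nonNeg : ∀ {p} → 0ℚ ℚ.≤ p → ∀ n → 0ℚ ℚ.≤ p ^ℚ n
^ℚ-nonNeg 0≤p zero    = ℚ.nonNegative⁻¹ 1ℚ
^ℚ-nonNeg 0≤p (suc n) = *-nonNeg 0≤p (^ℚ-nonNeg 0≤p n)

^ℚ-monoʳ-≤ : ∀ {p} → 1ℚ ℚ.≤ p → ∀ {m n} → m ℕ.≤ n → p ^ℚ m ℚ.≤ p ^ℚ n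
^ℚ-monoʳ-≤ {p} 1≤p = go
  where
  0≤p : 0ℚ ℚ.≤ p
  0≤p = ℚ.≤-trans (ℚ.nonNegative⁻¹ 1ℚ) 1≤p
  go : ∀ {m n} → m ℕ.≤ n → p ^ℚ m ℚ.≤ p ^ℚ n
  go {n = zero}  ℕ.z≤n       = ℚ.≤-refl
  go {n = suc n} ℕ.z≤n       = *-mono-≤-nonNeg (ℚ.nonNegative⁻¹ 1ℚ) 0≤p 1≤p (go {n = n} ℕ.z≤n)
  go             (ℕ.s≤s m≤n) = ℚ.*-monoˡ-≤-nonNeg p {{ℚ.nonNegative 0≤p}} (go m≤n)

-- Naturals inside the rationals and the Archimedean property.

fromℕ : ℕ → ℚ
fromℕ n = + n ℚ./ 1

-- `_/_` normalises through a gcd, which is stuck on a variable `n`; the `mkℚ` form lets sums,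
-- products and comparisons compute.
fromℕ≡mkℚ : ∀ n → fromℕ n ≡ ℚ.mkℚ (+ n) 0 (Coprime.sym (Coprime.1-coprimeTo n))
fromℕ≡mkℚ n = ℚ.normalize-coprime (Coprime.sym (Coprime.1-coprimeTo n))

fromℕ-* : ∀ m n → fromℕ (m ℕ.* n) ≡ fromℕ m ℚ.* fromℕ n
fromℕ-* m n = trans (cong (ℚ._/ 1) (ℤ.pos-* m n))
  (sym (cong₂ ℚ._*_ (fromℕ≡mkℚ m) (fromℕ≡mkℚ n)))

fromℕ-^ : ∀ m n → fromℕ (m ℕ.^ n) ≡ fromℕ m ^ℚ n
fromℕ-^ m zero    = refl
fromℕ-^ m (suc n) = trans (fromℕ-* m (m ℕ.^ n)) (cong (fromℕ m ℚ.*_) (fromℕ-^ m n))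

fromℕ-mono-≤ : ∀ {m n} → m ℕ.≤ n → fromℕ m ℚ.≤ fromℕ n
fromℕ-mono-≤ {m} {n} m≤n = subst₂ ℚ._≤_ (sym (fromℕ≡mkℚ m)) (sym (fromℕ≡mkℚ n))
  (ℚ.*≤* (ℤ.*-monoʳ-≤-nonNeg (+ 1) (ℤ.+≤+ m≤n)))

fromℕ-pos : ∀ n .{{_ : NonZero n}} → Positive (fromℕ n)
fromℕ-pos n = ℚ.normalize-pos n 1

1/n≡mkℚ : ∀ n → + 1 ℚ./ suc n ≡ ℚ.mkℚ (+ 1) n (Coprime.1-coprimeTo (suc n))
1/n≡mkℚ n = ℚ.normalize-coprime (Coprime.1-coprimeTo (suc n))

1/n*n≡1 : ∀ n .{{_ : NonZero n}} → (+ 1 ℚ./ n) ℚ.* fromℕ n ≡ 1ℚ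
1/n*n≡1 (suc n) = trans (cong₂ ℚ._*_ (1/n≡mkℚ n) (fromℕ≡mkℚ (suc n)))
  (ℚ.*-inverseˡ (ℚ.mkℚ (+ suc n) 0 (Coprime.sym (Coprime.1-coprimeTo (suc n)))))

-- A positive `ε` has numerator at least 1, so `ε` is at least `1 / suc d`, and every `n` from
-- `suc d` on works.
archimedean : ∀ ε .{{_ : Positive ε}} → Eventually (λ n → 1ℚ ℚ.≤ fromℕ n ℚ.* ε)
archimedean ε@(ℚ.mkℚ ℤ.+[1+ a ] d _) = suc d , λ n d<n → begin
  1ℚ                                   ≡⟨ 1/n*n≡1 (suc d) ⟨
  (+ 1 ℚ./ suc d) ℚ.* fromℕ (suc d)    ≡⟨ ℚ.*-comm (+ 1 ℚ./ suc d) (fromℕ (suc d)) ⟩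
  fromℕ (suc d) ℚ.* (+ 1 ℚ./ suc d)    ≤⟨ *-mono-≤-nonNeg
                                            (ℚ.nonNegative⁻¹ (+ 1 ℚ./ suc d) {{ℚ.normalize-nonNeg 1 (suc d)}})
                                            (ℚ.nonNegative⁻¹ (fromℕ n) {{ℚ.normalize-nonNeg n 1}})
                                            (fromℕ-mono-≤ d<n)
                                            1/d≤ε ⟩
  fromℕ n ℚ.* ε                        ∎
  where
  open ℚ.≤-Reasoning
  1/d≤ε : + 1 ℚ./ suc d ℚ.≤ ε
  1/d≤ε = subst (ℚ._≤ ε) (sym (1/n≡mkℚ d))
    (ℚ.*≤* (ℤ.*-monoʳ-≤-nonNeg (+ suc d) (ℤ.+≤+ (ℕ.s≤s (ℕ.z≤n {a})))))

-- Factorials, rising factorials and the exponent m - 1.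

-- One more factor `b` turns the integer exponent m - 1, which is -1 at m = 0, into the natural
-- exponent `m`. Later arguments multiply by the base first, so the case m = 0 is split off only
-- here.
^ℤ-pred-* : ∀ b .{{_ : NonZero b}} m → b ^ℤ (+ m ℤ.- + 1) ℚ.* fromℕ b ≡ fromℕ b ^ℚ m
^ℤ-pred-* b zero    = begin
  ℚ._/_ (+ 1) (b ℕ.^ 1) {{ℕ.m^n≢0 b 1}} ℚ.* fromℕ b
    ≡⟨ cong (ℚ._* fromℕ b) (ℚ./-cong {+ 1} {b ℕ.^ 1} {+ 1} {b} {{ℕ.m^n≢0 b 1}} refl (ℕ.^-identityʳ b)) ⟩
  (+ 1 ℚ./ b) ℚ.* fromℕ b
    ≡⟨ 1/n*n≡1 b ⟩
  1ℚ ∎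
  where open ≡-Reasoning
^ℤ-pred-* b (suc m) = trans (cong (ℚ._* fromℕ b) (fromℕ-^ b m)) (ℚ.*-comm (fromℕ b ^ℚ m) (fromℕ b))

!-*-pochhammer : ∀ m k → (m !) ℕ.* pochhammer (suc m) k ≡ (m ℕ.+ k) !
!-*-pochhammer m zero    = trans (ℕ.*-identityʳ (m !)) (cong _! (sym (ℕ.+-identityʳ m)))
!-*-pochhammer m (suc k) = begin
  (m !) ℕ.* (pochhammer (suc m) k ℕ.* suc (m ℕ.+ k))  ≡⟨ ℕ.*-assoc (m !) _ _ ⟨
  (m !) ℕ.* pochhammer (suc m) k ℕ.* suc (m ℕ.+ k)    ≡⟨ cong (ℕ._* suc (m ℕ.+ k)) (!-*-pochhammer m k) ⟩
  ((m ℕ.+ k) !) ℕ.* suc (m ℕ.+ k)                     ≡⟨ ℕ.*-comm ((m ℕ.+ k) !) _ ⟩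
  suc (m ℕ.+ k) !                                     ≡⟨ cong _! (ℕ.+-suc m k) ⟨
  (m ℕ.+ suc k) !                                     ∎
  where open ≡-Reasoning

factorialPower : ℕ → ℚ
factorialPower m = _^ℤ_ (m !) {{m ℕ.!≢0}} (+ m ℤ.- + 1)

factorialPower-* : ∀ m → factorialPower m ℚ.* fromℕ (m !) ≡ fromℕ (m !) ^ℚ m
factorialPower-* m = ^ℤ-pred-* (m !) {{m ℕ.!≢0}} m

-- This is the recursion behind the telescoping, used with `k` equal to `γ`. Multiplying by (m + k)!
-- = m! (m + 1)ₖ supplies each base of exponent m - 1 with its missing factor; what remains is the
-- law of exponents for `F ^ℚ (m + k)`.
factorialPower-+ : ∀ m k →
  factorialPower m ℚ.* (fromℕ (((m ℕ.+ k) !) ℕ.^ k)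
    ℚ.* _^ℤ_ (pochhammer (suc m) k) {{pochhammer≢0 m k}} (+ m ℤ.- + 1))
  ≡ factorialPower (m ℕ.+ k)
factorialPower-+ m k = *-cancelʳ-≡ F {{fromℕ-pos ((m ℕ.+ k) !) {{(m ℕ.+ k) ℕ.!≢0}}}} (begin
  a ℚ.* (fromℕ (((m ℕ.+ k) !) ℕ.^ k) ℚ.* b) ℚ.* F
    ≡⟨ cong₂ (λ x y → a ℚ.* (x ℚ.* b) ℚ.* y) (fromℕ-^ ((m ℕ.+ k) !) k) F≡ ⟩
  a ℚ.* (F ^ℚ k ℚ.* b) ℚ.* (M ℚ.* P)
    ≡⟨ solve 5 (λ a b c d e → a :* (c :* b) :* (d :* e) := (a :* d) :* (b :* e) :* c) refl a b (F ^ℚ k) M P ⟩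
  (a ℚ.* M) ℚ.* (b ℚ.* P) ℚ.* F ^ℚ k
    ≡⟨ cong₂ (λ x y → x ℚ.* y ℚ.* F ^ℚ k) (factorialPower-* m)
             (^ℤ-pred-* (pochhammer (suc m) k) {{pochhammer≢0 m k}} m) ⟩
  M ^ℚ m ℚ.* P ^ℚ m ℚ.* F ^ℚ k
    ≡⟨ cong (ℚ._* F ^ℚ k) (trans (^-congˡ m F≡) (^-distrib-* M P m)) ⟨
  F ^ℚ m ℚ.* F ^ℚ k
    ≡⟨ ^-homo-* F m k ⟨
  F ^ℚ (m ℕ.+ k)
    ≡⟨ factorialPower-* (m ℕ.+ k) ⟨
  factorialPower (m ℕ.+ k) ℚ.* F ∎)
  where
  open ≡-Reasoning
  F = fromℕ ((m ℕ.+ k) !)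
  M = fromℕ (m !)
  P = fromℕ (pochhammer (suc m) k)
  a = factorialPower m
  b = _^ℤ_ (pochhammer (suc m) k) {{pochhammer≢0 m k}} (+ m ℤ.- + 1)
  F≡ : F ≡ M ℚ.* P
  F≡ = trans (cong fromℕ (sym (!-*-pochhammer m k))) (fromℕ-* (m !) (pochhammer (suc m) k))

-- Sequences whose consecutive ratio tends to 0.

Eventually-× : {P Q : ℕ → Set} → Eventually P → Eventually Q → Eventually (λ n → P n × Q n)
Eventually-× (K , p) (L , q) = K ℕ.⊔ L , λ n n≥ →
  p n (ℕ.m⊔n≤o⇒m≤o K L n≥) , q n (ℕ.m⊔n≤o⇒n≤o K L n≥)

NonNeg : (ℕ → ℚ) → Set
NonNeg w = ∀ m → 0ℚ ℚ.≤ w m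

-- The ratio is stated without division, so `w` may take the value 0.
RatioVanishes : (ℕ → ℚ) → Set
RatioVanishes w = ∀ η → 0ℚ ℚ.< η → Eventually (λ m → w (suc m) ℚ.≤ η ℚ.* w m)

-- A ratio below 1/B bounds w m B ^ m by some c, and then a ratio below
-- ε/(B c) makes it at most ε.
ratioVanishes⇒*^-vanishes : ∀ {w} → NonNeg w → RatioVanishes w → ∀ B → 0ℚ ℚ.< B →
  ∀ ε → 0ℚ ℚ.< ε → Eventually (λ m → w m ℚ.* B ^ℚ m ℚ.≤ ε)
ratioVanishes⇒*^-vanishes {w} 0≤w ratio B 0<B ε 0<ε = vanishing bounded
  where
  open ℚ.≤-Reasoning
  0≤B = ℚ.<⇒≤ 0<B

  u : ℕ → ℚ
  u m = w m ℚ.* B ^ℚ m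

  0≤u : ∀ m → 0ℚ ℚ.≤ u m
  0≤u m = *-nonNeg (0≤w m) (^ℚ-nonNeg 0≤B m)

  u-ratio : ∀ {η} m → w (suc m) ℚ.≤ η ℚ.* w m → u (suc m) ℚ.≤ B ℚ.* η ℚ.* u m
  u-ratio {η} m le = begin
    w (suc m) ℚ.* (B ℚ.* B ^ℚ m)      ≤⟨ ℚ.*-monoʳ-≤-nonNeg (B ^ℚ suc m)
                                           {{ℚ.nonNegative (^ℚ-nonNeg 0≤B (suc m))}} le ⟩
    η ℚ.* w m ℚ.* (B ℚ.* B ^ℚ m)      ≡⟨ solve 4 (λ e w b p → e :* w :* (b :* p) := b :* e :* (w :* p))
                                           refl η (w m) B (B ^ℚ m) ⟩
    B ℚ.* η ℚ.* (w m ℚ.* B ^ℚ m)      ∎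

  bounded : ∃ λ c → 0ℚ ℚ.< c × Eventually (λ m → u m ℚ.≤ c)
  bounded with quotient 1ℚ B (ℚ.positive⁻¹ 1ℚ) 0<B
  ... | η , 0<η , Bη≡1 with ratio η 0<η
  -- From `K` on `u` does not increase, so `u K` is already a bound; adding 1 makes it strictly
  -- positive, as the division by `B * c` below requires.
  ...   | K , le = 1ℚ ℚ.+ u K , ℚ.+-mono-<-≤ (ℚ.positive⁻¹ 1ℚ) (0≤u K) , K , λ m m≥ → begin
      u m                  ≡⟨ cong u (ℕ.m∸n+n≡m m≥) ⟨
      u (m ℕ.∸ K ℕ.+ K)    ≤⟨ antitone (m ℕ.∸ K) ⟩
      u K                  ≡⟨ ℚ.+-identityˡ (u K) ⟨
      0ℚ ℚ.+ u K           ≤⟨ ℚ.+-monoˡ-≤ (u K) (ℚ.nonNegative⁻¹ 1ℚ) ⟩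
      1ℚ ℚ.+ u K           ∎
    where
    antitone : ∀ k → u (k ℕ.+ K) ℚ.≤ u K
    antitone zero    = ℚ.≤-refl
    antitone (suc k) = begin
      u (suc k ℕ.+ K)            ≤⟨ u-ratio (k ℕ.+ K) (le (k ℕ.+ K) (ℕ.m≤n+m K k)) ⟩
      B ℚ.* η ℚ.* u (k ℕ.+ K)    ≡⟨ cong (ℚ._* u (k ℕ.+ K)) Bη≡1 ⟩
      1ℚ ℚ.* u (k ℕ.+ K)         ≡⟨ ℚ.*-identityˡ (u (k ℕ.+ K)) ⟩
      u (k ℕ.+ K)                ≤⟨ antitone k ⟩
      u K                        ∎

  vanishing : (∃ λ c → 0ℚ ℚ.< c × Eventually (λ m → u m ℚ.≤ c)) → Eventually (λ m → u m ℚ.≤ ε)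
  vanishing (c , 0<c , u≤c) with quotient ε (B ℚ.* c) 0<ε (*-pos 0<B 0<c)
  ... | η , 0<η , Bcη≡ε with Eventually-× u≤c (ratio η 0<η)
  -- The estimates at `m` control `u (suc m)`, hence the threshold moves up by one.
  ...   | K , h = suc K , λ { (suc m) (ℕ.s≤s m≥) → let u≤c , le = h m m≥ in begin
      u (suc m)          ≤⟨ u-ratio m le ⟩
      B ℚ.* η ℚ.* u m    ≤⟨ ℚ.*-monoˡ-≤-nonNeg (B ℚ.* η)
                              {{ℚ.nonNegative (*-nonNeg 0≤B (ℚ.<⇒≤ 0<η))}} u≤c ⟩
      B ℚ.* η ℚ.* c      ≡⟨ solve 3 (λ b e c → b :* e :* c := b :* c :* e) refl B η c ⟩
      B ℚ.* c ℚ.* η      ≡⟨ Bcη≡ε ⟩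
      ε                  ∎ }

-- General absolute values and convergence in the completion.

seq-^ : ∀ {v} (x : Completion v) k j → seq (x ^ k) j ≡ seq x j ^ℚ k
seq-^ x zero    j = refl
seq-^ x (suc k) j = cong (seq x j ℚ.*_) (seq-^ x k j)

module _ (v : AbsoluteValue) where
  open AbsoluteValue v

  -- Multiplicativity gives |1| |1| = |1|, and |1| can be cancelled when it is at least 1.
  ∣1∣≤1 : ∣ 1ℚ ∣ ℚ.≤ 1ℚ
  ∣1∣≤1 with ℚ.≤-total ∣ 1ℚ ∣ 1ℚ
  ... | inj₁ ≤1 = ≤1
  ... | inj₂ 1≤ = ℚ.≤-reflexive (*-cancelʳ-≡ ∣ 1ℚ ∣
    {{ℚ.positive (ℚ.<-≤-trans (ℚ.positive⁻¹ 1ℚ) 1≤)}}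
    (trans (sym (∣x*y∣ 1ℚ 1ℚ)) (sym (ℚ.*-identityˡ ∣ 1ℚ ∣))))

  -- If |-1| is at least 1, it is at most its own square, which is |1|.
  ∣-1∣≤1 : ∣ ℚ.- 1ℚ ∣ ℚ.≤ 1ℚ
  ∣-1∣≤1 with ℚ.≤-total ∣ ℚ.- 1ℚ ∣ 1ℚ
  ... | inj₁ ≤1 = ≤1
  ... | inj₂ 1≤ = begin
    ∣ ℚ.- 1ℚ ∣                    ≡⟨ ℚ.*-identityʳ _ ⟨
    ∣ ℚ.- 1ℚ ∣ ℚ.* 1ℚ             ≤⟨ ℚ.*-monoˡ-≤-nonNeg ∣ ℚ.- 1ℚ ∣ {{ℚ.nonNegative (0≤∣ ℚ.- 1ℚ ∣)}} 1≤ ⟩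
    ∣ ℚ.- 1ℚ ∣ ℚ.* ∣ ℚ.- 1ℚ ∣     ≡⟨ ∣x*y∣ (ℚ.- 1ℚ) (ℚ.- 1ℚ) ⟨
    ∣ 1ℚ ∣                        ≤⟨ ∣1∣≤1 ⟩
    1ℚ                            ∎
    where open ℚ.≤-Reasoning

  ∣^∣≤ : ∀ {B} r → 0ℚ ℚ.≤ B → ∣ r ∣ ℚ.≤ B → ∀ k → ∣ r ^ℚ k ∣ ℚ.≤ B ^ℚ k
  ∣^∣≤ r 0≤B r≤B zero = ∣1∣≤1
  ∣^∣≤ {B} r 0≤B r≤B (suc k) = begin
    ∣ r ℚ.* r ^ℚ k ∣        ≡⟨ ∣x*y∣ r (r ^ℚ k) ⟩
    ∣ r ∣ ℚ.* ∣ r ^ℚ k ∣    ≤⟨ *-mono-≤-nonNeg (0≤∣ r ^ℚ k ∣) 0≤B r≤B (∣^∣≤ r 0≤B r≤B k) ⟩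
    B ℚ.* B ^ℚ k            ∎
    where open ℚ.≤-Reasoning

  -- The triangle inequality for q = (q + x) - x. It keeps the denominators q + (m!)^(N m) away from
  -- 0 once the power is small.
  ½∣q∣≤∣q+x∣ : ∀ q x → ∣ x ∣ ℚ.≤ ½ ℚ.* ∣ q ∣ → ½ ℚ.* ∣ q ∣ ℚ.≤ ∣ q ℚ.+ x ∣
  ½∣q∣≤∣q+x∣ q x ∣x∣≤ = begin
    h                                       ≡⟨ solve 1 (λ h → h := h :+ h :- h) refl h ⟩
    h ℚ.+ h ℚ.- h                           ≡⟨ cong (ℚ._- h) (½*p+½*p≡p ∣ q ∣) ⟩
    ∣ q ∣ ℚ.- h                             ≤⟨ ℚ.+-monoˡ-≤ (ℚ.- h) ∣q∣≤ ⟩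
    ∣ q ℚ.+ x ∣ ℚ.+ h ℚ.- h                 ≡⟨ solve 2 (λ d h → d :+ h :- h := d) refl ∣ q ℚ.+ x ∣ h ⟩
    ∣ q ℚ.+ x ∣                             ∎
    where
    open ℚ.≤-Reasoning
    h = ½ ℚ.* ∣ q ∣
    ∣q∣≤ : ∣ q ∣ ℚ.≤ ∣ q ℚ.+ x ∣ ℚ.+ h
    ∣q∣≤ = begin
      ∣ q ∣                                             ≡⟨ cong ∣_∣ (solve 2 (λ q x → q := q :+ x :+ con (ℚ.- 1ℚ) :* x) refl q x) ⟩
      ∣ q ℚ.+ x ℚ.+ ℚ.- 1ℚ ℚ.* x ∣                      ≤⟨ ∣x+y∣≤ (q ℚ.+ x) (ℚ.- 1ℚ ℚ.* x) ⟩
      ∣ q ℚ.+ x ∣ ℚ.+ ∣ ℚ.- 1ℚ ℚ.* x ∣                  ≤⟨ ℚ.+-monoʳ-≤ ∣ q ℚ.+ x ∣ (begin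
        ∣ ℚ.- 1ℚ ℚ.* x ∣              ≡⟨ ∣x*y∣ (ℚ.- 1ℚ) x ⟩
        ∣ ℚ.- 1ℚ ∣ ℚ.* ∣ x ∣          ≤⟨ ℚ.*-monoʳ-≤-nonNeg ∣ x ∣ {{ℚ.nonNegative (0≤∣ x ∣)}} ∣-1∣≤1 ⟩
        1ℚ ℚ.* ∣ x ∣                  ≡⟨ ℚ.*-identityˡ ∣ x ∣ ⟩
        ∣ x ∣                         ≤⟨ ∣x∣≤ ⟩
        h                             ∎) ⟩
      ∣ q ℚ.+ x ∣ ℚ.+ h                                 ∎

  ∣∣-pos : ∀ x .{{_ : Positive x}} → 0ℚ ℚ.< ∣ x ∣
  ∣∣-pos x = ℚ.positive⁻¹ ∣ x ∣
    {{ℚ.nonNeg∧nonZero⇒pos ∣ x ∣ {{ℚ.nonNegative (0≤∣ x ∣)}}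
      {{ℚ.≢-nonZero (λ eq → ℚ.<⇒≢ (ℚ.positive⁻¹ x) (sym (∣x∣≡0⇒x≡0 x eq)))}}}}

  -- Positivity of the real `ε` provides a rational `η` that is eventually below `seq ε`. One half
  -- of `η` bounds the distance, the other half is the gap demanded by `_<ℝ_`.
  pointwise⇒converges : ∀ (s : ℕ → Completion v) L →
    (∀ η → 0ℚ ℚ.< η → Eventually (λ n → Eventually (λ j → ∣ seq (s n) j ℚ.- seq L j ∣ ℚ.≤ η))) →
    Converges s L
  pointwise⇒converges s L close ε (η , 0<η , E , 0+η≤ε) with close (½ ℚ.* η) (*-pos 0<½ 0<η)
  ... | K , h = K , λ n n≥ → ½ ℚ.* η , *-pos 0<½ 0<η , eventually≤ n (h n n≥)
    where
    open ℚ.≤-Reasoning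
    eventually≤ : ∀ n → Eventually (λ j → ∣ seq (s n) j ℚ.- seq L j ∣ ℚ.≤ ½ ℚ.* η) →
                  Eventually (λ j → ∣ seq (s n) j ℚ.- seq L j ∣ ℚ.+ ½ ℚ.* η ℚ.≤ seq ε j)
    eventually≤ n (J , d≤½η) = E ℕ.⊔ J , λ j j≥ → begin
      ∣ seq (s n) j ℚ.- seq L j ∣ ℚ.+ ½ ℚ.* η    ≤⟨ ℚ.+-monoˡ-≤ (½ ℚ.* η) (d≤½η j (ℕ.m⊔n≤o⇒n≤o E J j≥)) ⟩
      ½ ℚ.* η ℚ.+ ½ ℚ.* η                        ≡⟨ ½*p+½*p≡p η ⟩
      η                                          ≡⟨ ℚ.+-identityˡ η ⟨
      0ℚ ℚ.+ η                                   ≤⟨ 0+η≤ε j (ℕ.m⊔n≤o⇒m≤o E J j≥) ⟩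
      seq ε j                                    ∎

-- Telescoping, and reduction to a bound on the coefficients.

module _ (q : ℚ) .{{q>0 : Positive q}} (γ δ N : ℕ) where

  coeff : ℕ → ℚ
  coeff m = (factorialPower m ℚ.÷ denom q {{q>0}} γ δ N m) {{denom≢0 q {{q>0}} γ δ N m}}

  -- T n at a rational approximation `r` of `x`, so that telescoping becomes an exact identity of
  -- rationals at each index of the Cauchy sequence.
  term : ℚ → ℕ → ℚ
  term r n = coeff (γ ℕ.* n ℕ.+ δ) ℚ.* r ^ℚ (γ ℕ.* n)

  module _ {v : AbsoluteValue} (x : Completion v) where

    summand≡Δterm : ∀ n j →
      seq (summand q {{q>0}} γ δ N x n) j ≡ term (seq x j) (suc n) ℚ.- term (seq x j) n
    summand≡Δterm n j = begin
      a ℚ.* seq (x ^ (γ ℕ.* n)) j ℚ.* (c ℚ.* d′ ℚ.* seq (x ^ γ) j ℚ.- 1ℚ ℚ.* d)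
        ≡⟨ cong₂ (λ y z → a ℚ.* y ℚ.* (c ℚ.* d′ ℚ.* z ℚ.- 1ℚ ℚ.* d)) (seq-^ x (γ ℕ.* n) j) (seq-^ x γ j) ⟩
      a ℚ.* r ^ℚ (γ ℕ.* n) ℚ.* (c ℚ.* d′ ℚ.* r ^ℚ γ ℚ.- 1ℚ ℚ.* d)
        ≡⟨ solve 6 (λ a y c d′ z d → a :* y :* (c :* d′ :* z :- con 1ℚ :* d)
                                       := a :* c :* d′ :* (z :* y) :- a :* d :* y)
             refl a (r ^ℚ (γ ℕ.* n)) c d′ (r ^ℚ γ) d ⟩
      -- `a * c` is the factorial power at `m′` by `factorialPower-+`, and the two powers of `r`
      -- combine to the exponent `γ * suc n`.
      a ℚ.* c ℚ.* d′ ℚ.* (r ^ℚ γ ℚ.* r ^ℚ (γ ℕ.* n)) ℚ.- term r n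
        ≡⟨ cong₂ (λ y z → y ℚ.* d′ ℚ.* z ℚ.- term r n) ac≡
             (trans (sym (^-homo-* r γ (γ ℕ.* n))) (cong (r ^ℚ_) (sym (ℕ.*-suc γ n)))) ⟩
      term r (suc n) ℚ.- term r n ∎
      where
      open ≡-Reasoning
      r  = seq x j
      m  = γ ℕ.* n ℕ.+ δ
      m′ = γ ℕ.* suc n ℕ.+ δ
      a  = factorialPower m
      c  = fromℕ ((m′ !) ℕ.^ γ) ℚ.* _^ℤ_ (pochhammer (suc m) γ) {{pochhammer≢0 m γ}} (+ m ℤ.- + 1)
      d  = ℚ.1/_ (denom q {{q>0}} γ δ N m) {{denom≢0 q {{q>0}} γ δ N m}}
      d′ = ℚ.1/_ (denom q {{q>0}} γ δ N m′) {{denom≢0 q {{q>0}} γ δ N m′}}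
      m+γ≡m′ : m ℕ.+ γ ≡ m′
      m+γ≡m′ = begin
        γ ℕ.* n ℕ.+ δ ℕ.+ γ      ≡⟨ ℕ.+-comm m γ ⟩
        γ ℕ.+ (γ ℕ.* n ℕ.+ δ)    ≡⟨ ℕ.+-assoc γ (γ ℕ.* n) δ ⟨
        γ ℕ.+ γ ℕ.* n ℕ.+ δ      ≡⟨ cong (ℕ._+ δ) (ℕ.*-suc γ n) ⟨
        m′                       ∎
      ac≡ : a ℚ.* c ≡ factorialPower m′
      ac≡ = subst (λ k → a ℚ.* (fromℕ ((k !) ℕ.^ γ) ℚ.*
                     _^ℤ_ (pochhammer (suc m) γ) {{pochhammer≢0 m γ}} (+ m ℤ.- + 1)) ≡ factorialPower k)
                  m+γ≡m′ (factorialPower-+ m γ)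

    -- The partial sums telescope to T n - T 0, and `total` unfolds to - T 0, so the remaining error
    -- is exactly T n.
    partialSum-total≡term : ∀ n j →
      seq (partialSum (summand q {{q>0}} γ δ N x) n) j ℚ.- seq (ι {v} (total q {{q>0}} γ δ N)) j ≡ term (seq x j) n
    partialSum-total≡term zero j = begin
      0ℚ ℚ.- (ℚ.- coeff δ)                               ≡⟨ solve 1 (λ a → con 0ℚ :- (:- a) := a :* con 1ℚ) refl (coeff δ) ⟩
      coeff (0 ℕ.+ δ) ℚ.* seq x j ^ℚ 0                   ≡⟨ cong (λ k → coeff (k ℕ.+ δ) ℚ.* seq x j ^ℚ k) (ℕ.*-zeroʳ γ) ⟨
      term (seq x j) 0                                   ∎
      where open ≡-Reasoning
    partialSum-total≡term (suc n) j = begin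
      s ℚ.+ seq (summand q {{q>0}} γ δ N x n) j ℚ.- t
        ≡⟨ cong (λ y → s ℚ.+ y ℚ.- t) (summand≡Δterm n j) ⟩
      s ℚ.+ (term r (suc n) ℚ.- term r n) ℚ.- t
        ≡⟨ solve 4 (λ s y z t → s :+ (y :- z) :- t := (s :- t) :+ (y :- z)) refl s (term r (suc n)) (term r n) t ⟩
      (s ℚ.- t) ℚ.+ (term r (suc n) ℚ.- term r n)
        ≡⟨ cong (ℚ._+ (term r (suc n) ℚ.- term r n)) (partialSum-total≡term n j) ⟩
      term r n ℚ.+ (term r (suc n) ℚ.- term r n)
        ≡⟨ solve 2 (λ y z → z :+ (y :- z) := y) refl (term r (suc n)) (term r n) ⟩
      term r (suc n) ∎
      where
      open ≡-Reasoning
      r = seq x j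
      s = seq (partialSum (summand q {{q>0}} γ δ N x) n) j
      t = seq (ι {v} (total q {{q>0}} γ δ N)) j

    open AbsoluteValue v

    -- A Cauchy sequence is eventually bounded, so powers of `x` grow at most geometrically, while
    -- `w` decays faster than any geometric sequence. The constant `c` leaves room for the factor
    -- ½|q| of the p-adic estimate.
    dominated⇒hasSum : .{{_ : NonZero γ}} → ∀ {w c} → NonNeg w → RatioVanishes w → 0ℚ ℚ.< c →
      Eventually (λ m → c ℚ.* ∣ coeff m ∣ ℚ.≤ w m) →
      HasSum (summand q {{q>0}} γ δ N x) (ι (total q {{q>0}} γ δ N))
    dominated⇒hasSum {w} {c} 0≤w ratio 0<c dominated =
      pointwise⇒converges v (partialSum (summand q {{q>0}} γ δ N x)) (ι (total q {{q>0}} γ δ N))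
        (close (cauchy-bounded v (seq x) (cauchy x)))
      where
      open ℚ.≤-Reasoning
      close : Bounded v (seq x) → ∀ η → 0ℚ ℚ.< η → Eventually (λ n → Eventually (λ j →
                ∣ seq (partialSum (summand q {{q>0}} γ δ N x) n) j ℚ.- seq (ι {v} (total q {{q>0}} γ δ N)) j ∣ ℚ.≤ η))
      close (A , 0<A , J , x≤A) η 0<η = conclude (Eventually-× dominated
          -- The target `c * η` becomes `η` after cancelling `c` in `term≤`.
          (ratioVanishes⇒*^-vanishes 0≤w ratio B 0<B (c ℚ.* η) (*-pos 0<c 0<η)))
        where
        -- With `B` at least 1, the exponent γ n may be raised to m = γ n + δ, the index at which
        -- `w` is evaluated.
        B = 1ℚ ℚ.+ A
        1≤B : 1ℚ ℚ.≤ B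
        1≤B = subst (ℚ._≤ B) (ℚ.+-identityʳ 1ℚ) (ℚ.+-monoʳ-≤ 1ℚ (ℚ.<⇒≤ 0<A))
        A≤B : A ℚ.≤ B
        A≤B = subst (ℚ._≤ B) (ℚ.+-identityˡ A) (ℚ.+-monoˡ-≤ A (ℚ.nonNegative⁻¹ 1ℚ))
        0<B : 0ℚ ℚ.< B
        0<B = ℚ.<-≤-trans (ℚ.positive⁻¹ 1ℚ) 1≤B
        -- Since γ is positive, a threshold for `m` also serves as a threshold for `n`.
        n≤m : ∀ n → n ℕ.≤ γ ℕ.* n ℕ.+ δ
        n≤m n = ℕ.≤-trans (ℕ.m≤n*m n γ) (ℕ.m≤m+n (γ ℕ.* n) δ)
        term≤ : ∀ n r → let m = γ ℕ.* n ℕ.+ δ in ∣ r ∣ ℚ.≤ B → c ℚ.* ∣ coeff m ∣ ℚ.≤ w m →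
                w m ℚ.* B ^ℚ m ℚ.≤ c ℚ.* η → ∣ term r n ∣ ℚ.≤ η
        term≤ n r r≤B cA≤w wB^m≤ = ℚ.*-cancelˡ-≤-pos c {{ℚ.positive 0<c}} (begin
          c ℚ.* ∣ coeff m ℚ.* r ^ℚ (γ ℕ.* n) ∣
            ≡⟨ cong (c ℚ.*_) (∣x*y∣ (coeff m) (r ^ℚ (γ ℕ.* n))) ⟩
          c ℚ.* (∣ coeff m ∣ ℚ.* ∣ r ^ℚ (γ ℕ.* n) ∣)
            ≡⟨ ℚ.*-assoc c ∣ coeff m ∣ ∣ r ^ℚ (γ ℕ.* n) ∣ ⟨
          c ℚ.* ∣ coeff m ∣ ℚ.* ∣ r ^ℚ (γ ℕ.* n) ∣
            ≤⟨ *-mono-≤-nonNeg (0≤∣ r ^ℚ (γ ℕ.* n) ∣) (0≤w m) cA≤w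
                 (ℚ.≤-trans (∣^∣≤ v r (ℚ.<⇒≤ 0<B) r≤B (γ ℕ.* n)) (^ℚ-monoʳ-≤ 1≤B (ℕ.m≤m+n (γ ℕ.* n) δ))) ⟩
          w m ℚ.* B ^ℚ m
            ≤⟨ wB^m≤ ⟩
          c ℚ.* η ∎)
          where m = γ ℕ.* n ℕ.+ δ
        conclude : Eventually (λ m → c ℚ.* ∣ coeff m ∣ ℚ.≤ w m × w m ℚ.* B ^ℚ m ℚ.≤ c ℚ.* η) →
                   Eventually (λ n → Eventually (λ j →
                     ∣ seq (partialSum (summand q {{q>0}} γ δ N x) n) j ℚ.- seq (ι {v} (total q {{q>0}} γ δ N)) j ∣ ℚ.≤ η))
        conclude (K , h) = K , λ n n≥ → J , λ j j≥ →
          let cA≤w , wB^m≤ = h (γ ℕ.* n ℕ.+ δ) (ℕ.≤-trans n≥ (n≤m n)) in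
          subst (λ y → ∣ y ∣ ℚ.≤ η) (sym (partialSum-total≡term n j))
            (term≤ n (seq x j) (ℚ.≤-trans (x≤A j j≥) A≤B) cA≤w wB^m≤)

  -- Clears the denominator and the exponent m - 1 together; the real and the p-adic bounds on
  -- `coeff` both come from cancelling in this identity.
  coeff-* : ∀ m → coeff m ℚ.* (denom q {{q>0}} γ δ N m ℚ.* fromℕ (m !)) ≡ fromℕ (m !) ^ℚ m
  coeff-* m = begin
    coeff m ℚ.* (d ℚ.* fromℕ (m !))          ≡⟨ ℚ.*-assoc (coeff m) d (fromℕ (m !)) ⟨
    coeff m ℚ.* d ℚ.* fromℕ (m !)            ≡⟨ cong (ℚ._* fromℕ (m !)) (÷-cancel (factorialPower m) d {{denom≢0 q {{q>0}} γ δ N m}}) ⟩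
    factorialPower m ℚ.* fromℕ (m !)         ≡⟨ factorialPower-* m ⟩
    fromℕ (m !) ^ℚ m                         ∎
    where
    open ≡-Reasoning
    d = denom q {{q>0}} γ δ N m

-- The real case: coefficients bounded by 1 / m!.

1/! : ℕ → ℚ
1/! m = ℚ._/_ (+ 1) (m !) {{m ℕ.!≢0}}

1/!-nonNeg : NonNeg 1/!
1/!-nonNeg m = ℚ.nonNegative⁻¹ (1/! m) {{ℚ.normalize-nonNeg 1 (m !) {{m ℕ.!≢0}}}}

1/!*!≡1 : ∀ m → 1/! m ℚ.* fromℕ (m !) ≡ 1ℚ
1/!*!≡1 m = 1/n*n≡1 (m !) {{m ℕ.!≢0}}

1/!-suc : ∀ m → 1/! (suc m) ℚ.* fromℕ (suc m) ≡ 1/! m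
1/!-suc m = *-cancelʳ-≡ (fromℕ (m !)) {{fromℕ-pos (m !) {{m ℕ.!≢0}}}} (begin
  1/! (suc m) ℚ.* fromℕ (suc m) ℚ.* fromℕ (m !)      ≡⟨ ℚ.*-assoc (1/! (suc m)) (fromℕ (suc m)) (fromℕ (m !)) ⟩
  1/! (suc m) ℚ.* (fromℕ (suc m) ℚ.* fromℕ (m !))    ≡⟨ cong (1/! (suc m) ℚ.*_) (fromℕ-* (suc m) (m !)) ⟨
  1/! (suc m) ℚ.* fromℕ (suc m !)                    ≡⟨ 1/!*!≡1 (suc m) ⟩
  1ℚ                                                 ≡⟨ 1/!*!≡1 m ⟨
  1/! m ℚ.* fromℕ (m !)                              ∎)
  where open ≡-Reasoning

1/!-ratioVanishes : RatioVanishes 1/!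
1/!-ratioVanishes η 0<η with archimedean η {{ℚ.positive 0<η}}
... | K , 1≤n*η = K , λ m m≥ → begin
  1/! (suc m)                                ≡⟨ ℚ.*-identityʳ (1/! (suc m)) ⟨
  1/! (suc m) ℚ.* 1ℚ                         ≤⟨ ℚ.*-monoˡ-≤-nonNeg (1/! (suc m)) {{ℚ.nonNegative (1/!-nonNeg (suc m))}}
                                                  (1≤n*η (suc m) (ℕ.m≤n⇒m≤1+n m≥)) ⟩
  1/! (suc m) ℚ.* (fromℕ (suc m) ℚ.* η)      ≡⟨ ℚ.*-assoc (1/! (suc m)) (fromℕ (suc m)) η ⟨
  1/! (suc m) ℚ.* fromℕ (suc m) ℚ.* η        ≡⟨ cong (ℚ._* η) (1/!-suc m) ⟩
  1/! m ℚ.* η                                ≡⟨ ℚ.*-comm (1/! m) η ⟩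
  η ℚ.* 1/! m                                ∎
  where open ℚ.≤-Reasoning

module _ (q : ℚ) .{{q>0 : Positive q}} (γ δ N : ℕ) .{{_ : NonZero N}} where

  -- After multiplication by d m!, the claim is (m!)^m ≤ d. This holds because N ≥ 1 makes (m!)^m at
  -- most (m!)^(N m), and q is positive.
  ∣coeff∣≤1/! : ∀ m → ℚ.∣ coeff q {{q>0}} γ δ N m ∣ ℚ.≤ 1/! m
  ∣coeff∣≤1/! m = ℚ.≤-trans (ℚ.≤-reflexive (ℚ.0≤p⇒∣p∣≡p 0≤a)) a≤1/m!
    where
    open ℚ.≤-Reasoning
    a = coeff q {{q>0}} γ δ N m
    e = (m !) ℕ.^ (N ℕ.* m)
    d = q ℚ.+ fromℕ e
    M = fromℕ (m !)
    aR≡ : a ℚ.* (d ℚ.* M) ≡ M ^ℚ m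
    aR≡ = coeff-* q {{q>0}} γ δ N m
    instance
      m!≢0 : NonZero (m !)
      m!≢0 = m ℕ.!≢0
      R-pos : Positive (d ℚ.* M)
      R-pos = ℚ.pos*pos⇒pos d {{ℚ.pos+nonNeg⇒pos q (fromℕ e) {{ℚ.normalize-nonNeg e 1}}}} M {{fromℕ-pos (m !)}}
    0≤a : 0ℚ ℚ.≤ a
    0≤a = ℚ.*-cancelʳ-≤-pos (d ℚ.* M) (begin
      0ℚ ℚ.* (d ℚ.* M)   ≡⟨ ℚ.*-zeroˡ (d ℚ.* M) ⟩
      0ℚ                 ≤⟨ ^ℚ-nonNeg (ℚ.nonNegative⁻¹ M {{ℚ.normalize-nonNeg (m !) 1}}) m ⟩
      M ^ℚ m             ≡⟨ aR≡ ⟨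
      a ℚ.* (d ℚ.* M)    ∎)
    a≤1/m! : a ℚ.≤ 1/! m
    a≤1/m! = ℚ.*-cancelʳ-≤-pos (d ℚ.* M) (begin
      a ℚ.* (d ℚ.* M)            ≡⟨ aR≡ ⟩
      M ^ℚ m                     ≡⟨ fromℕ-^ (m !) m ⟨
      fromℕ ((m !) ℕ.^ m)        ≤⟨ fromℕ-mono-≤ (ℕ.^-monoʳ-≤ (m !) (ℕ.m≤n*m m N)) ⟩
      fromℕ e                    ≡⟨ ℚ.+-identityˡ (fromℕ e) ⟨
      0ℚ ℚ.+ fromℕ e             ≤⟨ ℚ.+-monoˡ-≤ (fromℕ e) (ℚ.<⇒≤ (ℚ.positive⁻¹ q)) ⟩
      d                          ≡⟨ ℚ.*-identityˡ d ⟨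
      1ℚ ℚ.* d                   ≡⟨ cong (ℚ._* d) (1/!*!≡1 m) ⟨
      1/! m ℚ.* M ℚ.* d          ≡⟨ solve 3 (λ w m d → w :* m :* d := w :* (d :* m)) refl (1/! m) M d ⟩
      1/! m ℚ.* (d ℚ.* M)        ∎)

  usual-hasSum : .{{_ : NonZero γ}} (x : ℝ) →
    HasSum (summand q {{q>0}} γ δ N x) (ι (total q {{q>0}} γ δ N))
  usual-hasSum x = dominated⇒hasSum q {{q>0}} γ δ N x
    1/!-nonNeg 1/!-ratioVanishes (ℚ.positive⁻¹ 1ℚ)
    (0 , λ m _ → subst (ℚ._≤ 1/! m) (sym (ℚ.*-identityˡ ℚ.∣ coeff q {{q>0}} γ δ N m ∣)) (∣coeff∣≤1/! m))

-- Absolute values bounded by 1 on the naturals for which |m!| tends to 0.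

module _ (v : AbsoluteValue)
         (∣n∣≤1 : ∀ n → AbsoluteValue.∣_∣ v (fromℕ n) ℚ.≤ 1ℚ)
         (∣!∣-vanishes : ∀ η → 0ℚ ℚ.< η →
           Eventually (λ m → AbsoluteValue.∣_∣ v (fromℕ (m !)) ℚ.≤ η)) where
  open AbsoluteValue v

  -- Truncated `pred` differs from m - 1 only at m = 0, which the eventual statements below skip.
  ∣!^pred∣ : ℕ → ℚ
  ∣!^pred∣ m = ∣ fromℕ (m !) ^ℚ ℕ.pred m ∣

  ∣!^pred∣-nonNeg : NonNeg ∣!^pred∣
  ∣!^pred∣-nonNeg m = 0≤∣ fromℕ (m !) ^ℚ ℕ.pred m ∣

  -- Split ((m + 1)!)^m into (m + 1)^m and (m!)^m. The first factor has absolute value at most 1,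
  -- and the second contributes one extra |m!|, so the ratio is at most |m!|.
  ∣!^pred∣-ratioVanishes : RatioVanishes ∣!^pred∣
  ∣!^pred∣-ratioVanishes η 0<η with ∣!∣-vanishes η 0<η
  ... | K , ∣!∣≤η = suc K , λ { m@(suc k) (ℕ.s≤s k≥) → let M = fromℕ (m !); S = fromℕ (suc m) in begin
    ∣ fromℕ (suc m !) ^ℚ m ∣              ≡⟨ cong ∣_∣ (trans (^-congˡ m (fromℕ-* (suc m) (m !))) (^-distrib-* S M m)) ⟩
    ∣ S ^ℚ m ℚ.* M ^ℚ m ∣                 ≡⟨ ∣x*y∣ (S ^ℚ m) (M ^ℚ m) ⟩
    ∣ S ^ℚ m ∣ ℚ.* ∣ M ^ℚ m ∣             ≡⟨ cong (λ y → ∣ y ∣ ℚ.* ∣ M ^ℚ m ∣) (fromℕ-^ (suc m) m) ⟨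
    ∣ fromℕ (suc m ℕ.^ m) ∣ ℚ.* ∣ M ^ℚ m ∣
                                          ≤⟨ ℚ.*-monoʳ-≤-nonNeg ∣ M ^ℚ m ∣ {{ℚ.nonNegative (0≤∣ M ^ℚ m ∣)}} (∣n∣≤1 (suc m ℕ.^ m)) ⟩
    1ℚ ℚ.* ∣ M ^ℚ m ∣                     ≡⟨ ℚ.*-identityˡ ∣ M ^ℚ m ∣ ⟩
    ∣ M ℚ.* M ^ℚ k ∣                      ≡⟨ ∣x*y∣ M (M ^ℚ k) ⟩
    ∣ M ∣ ℚ.* ∣ M ^ℚ k ∣                  ≤⟨ ℚ.*-monoʳ-≤-nonNeg ∣ M ^ℚ k ∣ {{ℚ.nonNegative (0≤∣ M ^ℚ k ∣)}}
                                               (∣!∣≤η m (ℕ.m≤n⇒m≤1+n k≥)) ⟩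
    η ℚ.* ∣ M ^ℚ k ∣                      ∎ }
    where open ℚ.≤-Reasoning

  ∣b^e∣≤∣b∣ : ∀ b e .{{_ : NonZero e}} → ∣ fromℕ (b ℕ.^ e) ∣ ℚ.≤ ∣ fromℕ b ∣
  ∣b^e∣≤∣b∣ b (suc e) = begin
    ∣ fromℕ (b ℕ.* b ℕ.^ e) ∣               ≡⟨ cong ∣_∣ (fromℕ-* b (b ℕ.^ e)) ⟩
    ∣ fromℕ b ℚ.* fromℕ (b ℕ.^ e) ∣         ≡⟨ ∣x*y∣ (fromℕ b) (fromℕ (b ℕ.^ e)) ⟩
    ∣ fromℕ b ∣ ℚ.* ∣ fromℕ (b ℕ.^ e) ∣     ≤⟨ ℚ.*-monoˡ-≤-nonNeg ∣ fromℕ b ∣ {{ℚ.nonNegative (0≤∣ fromℕ b ∣)}} (∣n∣≤1 (b ℕ.^ e)) ⟩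
    ∣ fromℕ b ∣ ℚ.* 1ℚ                      ≡⟨ ℚ.*-identityʳ ∣ fromℕ b ∣ ⟩
    ∣ fromℕ b ∣                             ∎
    where open ℚ.≤-Reasoning

  module _ (q : ℚ) .{{q>0 : Positive q}} (γ δ N : ℕ) .{{_ : NonZero N}} where

    -- Once |m!| ≤ ½|q|, the power (m!)^(N m) is just as small and the denominator has absolute
    -- value at least ½|q|. Taking absolute values in `coeff-*` and cancelling |m!| gives the bound.
    ½∣q∣∣coeff∣≤∣!^pred∣ :
      Eventually (λ m → ½ ℚ.* ∣ q ∣ ℚ.* ∣ coeff q {{q>0}} γ δ N m ∣ ℚ.≤ ∣!^pred∣ m)
    ½∣q∣∣coeff∣≤∣!^pred∣ = conclude (∣!∣-vanishes h (*-pos 0<½ (∣∣-pos v q)))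
      where
      open ℚ.≤-Reasoning
      h = ½ ℚ.* ∣ q ∣
      bound : ∀ k → let m = suc k in ∣ fromℕ (m !) ∣ ℚ.≤ h →
              h ℚ.* ∣ coeff q {{q>0}} γ δ N m ∣ ℚ.≤ ∣ fromℕ (m !) ^ℚ k ∣
      bound k ∣M∣≤h = ℚ.*-cancelʳ-≤-pos ∣ M ∣ {{ℚ.positive (∣∣-pos v M {{fromℕ-pos (m !) {{m ℕ.!≢0}}}})}} (begin
        h ℚ.* ∣ a ∣ ℚ.* ∣ M ∣            ≡⟨ solve 3 (λ h a m → h :* a :* m := (a :* m) :* h) refl h (∣ a ∣) (∣ M ∣) ⟩
        ∣ a ∣ ℚ.* ∣ M ∣ ℚ.* h            ≤⟨ ℚ.*-monoˡ-≤-nonNeg (∣ a ∣ ℚ.* ∣ M ∣)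
                                              {{ℚ.nonNegative (*-nonNeg (0≤∣ a ∣) (0≤∣ M ∣))}} h≤∣d∣ ⟩
        ∣ a ∣ ℚ.* ∣ M ∣ ℚ.* ∣ d ∣        ≡⟨ solve 3 (λ a m d → a :* m :* d := a :* (d :* m)) refl (∣ a ∣) (∣ M ∣) (∣ d ∣) ⟩
        ∣ a ∣ ℚ.* (∣ d ∣ ℚ.* ∣ M ∣)      ≡⟨ cong (∣ a ∣ ℚ.*_) (∣x*y∣ d M) ⟨
        ∣ a ∣ ℚ.* ∣ d ℚ.* M ∣            ≡⟨ ∣x*y∣ a (d ℚ.* M) ⟨
        ∣ a ℚ.* (d ℚ.* M) ∣              ≡⟨ cong ∣_∣ (coeff-* q {{q>0}} γ δ N m) ⟩
        ∣ M ℚ.* M ^ℚ k ∣                 ≡⟨ ∣x*y∣ M (M ^ℚ k) ⟩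
        ∣ M ∣ ℚ.* ∣ M ^ℚ k ∣             ≡⟨ ℚ.*-comm ∣ M ∣ ∣ M ^ℚ k ∣ ⟩
        ∣ M ^ℚ k ∣ ℚ.* ∣ M ∣             ∎)
        where
        m = suc k
        M = fromℕ (m !)
        a = coeff q {{q>0}} γ δ N m
        d = denom q {{q>0}} γ δ N m
        h≤∣d∣ : h ℚ.≤ ∣ d ∣
        h≤∣d∣ = ½∣q∣≤∣q+x∣ v q (fromℕ ((m !) ℕ.^ (N ℕ.* m)))
          -- The exponent N m is nonzero because N and m = `suc k` are.
          (ℚ.≤-trans (∣b^e∣≤∣b∣ (m !) (N ℕ.* m) {{ℕ.m*n≢0 N m}}) ∣M∣≤h)
      conclude : Eventually (λ m → ∣ fromℕ (m !) ∣ ℚ.≤ h) →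
                 Eventually (λ m → h ℚ.* ∣ coeff q {{q>0}} γ δ N m ∣ ℚ.≤ ∣!^pred∣ m)
      conclude (K , ∣!∣≤h) = suc K , λ { (suc k) (ℕ.s≤s k≥) → bound k (∣!∣≤h (suc k) (ℕ.m≤n⇒m≤1+n k≥)) }

    nonArchimedean-hasSum : .{{_ : NonZero γ}} (x : Completion v) →
      HasSum (summand q {{q>0}} γ δ N x) (ι (total q {{q>0}} γ δ N))
    nonArchimedean-hasSum x = dominated⇒hasSum q {{q>0}} γ δ N x
      ∣!^pred∣-nonNeg ∣!^pred∣-ratioVanishes
      (*-pos 0<½ (∣∣-pos v q)) ½∣q∣∣coeff∣≤∣!^pred∣

-- The p-adic case: factorials tend to 0.

n≤m^n : ∀ {m} → 1 ℕ.< m → ∀ n → n ℕ.≤ m ℕ.^ n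
n≤m^n 1<m zero    = ℕ.z≤n
n≤m^n 1<m (suc n) = ℕ.≤-<-trans (n≤m^n 1<m n) (ℕ.^-monoʳ-< _ 1<m (ℕ.n<1+n n))

n∣n! : ∀ n .{{_ : NonZero n}} → n ℕᵈ.∣ n !
n∣n! (suc n) = ℕᵈ.m∣m*n (n !)

module _ {p : ℕ} (pr : Prime p) where
  open PAdic pr

  ∣n∣ₚ*p^ν≡1 : ∀ n .{{_ : NonZero n}} → ∣ fromℕ n ∣ₚ ℚ.* fromℕ (p ℕ.^ ν n) ≡ 1ℚ
  ∣n∣ₚ*p^ν≡1 n@(suc _) = begin
    ∣ fromℕ n ∣ₚ ℚ.* fromℕ P                          ≡⟨ cong (λ y → ∣ y ∣ₚ ℚ.* fromℕ P) (fromℕ≡mkℚ n) ⟩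
    -- The denominator of the integer `n` is 1, and `p ^ ν 1` divides 1.
    ℚ._/_ (+ (p ℕ.^ ν 1)) P ℚ.* fromℕ P               ≡⟨ cong (λ a → ℚ._/_ (+ a) P ℚ.* fromℕ P) (ℕᵈ.∣1⇒≡1 (p^ν∣n 1)) ⟩
    ℚ._/_ (+ 1) P ℚ.* fromℕ P                         ≡⟨ 1/n*n≡1 P ⟩
    1ℚ                                                ∎
    where
    open ≡-Reasoning
    P = p ℕ.^ ν n
    instance
      P≢0 : NonZero P
      P≢0 = ℕ.m^n≢0 p (ν n)

  ∣n∣ₚ≤ : ∀ n .{{_ : NonZero n}} η → 1ℚ ℚ.≤ fromℕ (p ℕ.^ ν n) ℚ.* η → ∣ fromℕ n ∣ₚ ℚ.≤ η
  ∣n∣ₚ≤ n η 1≤ = begin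
    ∣ fromℕ n ∣ₚ                                 ≡⟨ ℚ.*-identityʳ ∣ fromℕ n ∣ₚ ⟨
    ∣ fromℕ n ∣ₚ ℚ.* 1ℚ                          ≤⟨ ℚ.*-monoˡ-≤-nonNeg ∣ fromℕ n ∣ₚ {{ℚ.nonNegative (0≤∣ fromℕ n ∣ₚ)}} 1≤ ⟩
    ∣ fromℕ n ∣ₚ ℚ.* (fromℕ P ℚ.* η)             ≡⟨ ℚ.*-assoc ∣ fromℕ n ∣ₚ (fromℕ P) η ⟨
    ∣ fromℕ n ∣ₚ ℚ.* fromℕ P ℚ.* η               ≡⟨ cong (ℚ._* η) (∣n∣ₚ*p^ν≡1 n) ⟩
    1ℚ ℚ.* η                                     ≡⟨ ℚ.*-identityˡ η ⟩
    η                                            ∎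
    where
    open ℚ.≤-Reasoning
    P = p ℕ.^ ν n

  ∣n∣ₚ≤1 : ∀ n → ∣ fromℕ n ∣ₚ ℚ.≤ 1ℚ
  ∣n∣ₚ≤1 zero      = ℚ.nonNegative⁻¹ 1ℚ
  ∣n∣ₚ≤1 n@(suc _) = ∣n∣ₚ≤ n 1ℚ (ℚ.≤-trans
    (fromℕ-mono-≤ (ℕ.m^n>0 p (ν n))) (ℚ.≤-reflexive (sym (ℚ.*-identityʳ (fromℕ (p ℕ.^ ν n))))))

  -- For m ≥ p^K, p^K divides (p^K)!, which divides m!. Hence the exponent of p in m! is at least K,
  -- and the crude bound `n≤m^n` gives p^ν ≥ K, where K comes from the Archimedean property for `η`.
  ∣!∣ₚ-vanishes : ∀ η → 0ℚ ℚ.< η → Eventually (λ m → ∣ fromℕ (m !) ∣ₚ ℚ.≤ η)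
  ∣!∣ₚ-vanishes η 0<η with archimedean η {{ℚ.positive 0<η}}
  ... | K , 1≤n*η = p ℕ.^ K , λ m m≥ →
    ∣n∣ₚ≤ (m !) {{m ℕ.!≢0}} η (1≤n*η (p ℕ.^ ν (m !)) (K≤p^ν m m≥))
    where
    K≤p^ν : ∀ m → p ℕ.^ K ℕ.≤ m → K ℕ.≤ p ℕ.^ ν (m !)
    K≤p^ν m m≥ = ℕ.≤-trans
      (p^k∣n⇒k≤ν (m !) K {{m ℕ.!≢0}} (ℕᵈ.∣-trans (n∣n! (p ℕ.^ K) {{ℕ.m^n≢0 p K}}) (ℕᵈ.m≤n⇒m!∣n! m≥)))
      (n≤m^n (ℕ.nonTrivial⇒n>1 p {{prime⇒nonTrivial pr}}) (ν (m !)))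

theorem4p9 : (q : ℚ) .{{_ : Positive q}} (γ δ N : ℕ) .{{_ : NonZero γ}} .{{_ : NonZero N}} →
    ((x : ℝ) → x ≉ ι 0ℚ → HasSum (summand q γ δ N x) (ι (total q γ δ N)))
    ×
    ((p : ℕ) (pr : Prime p) (x : ℚₚ pr) → x ≉ ι 0ℚ →
    HasSum (summand q γ δ N x) (ι (total q γ δ N)))
theorem4p9 q {{q>0}} γ δ N =
    (λ x _ → usual-hasSum q {{q>0}} γ δ N x)
  , (λ p pr x _ → nonArchimedean-hasSum (p-adic pr) (∣n∣ₚ≤1 pr) (∣!∣ₚ-vanishes pr) q {{q>0}} γ δ N x)
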